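{- Let $G$ be a connected graph. For any proper subset $S \subsetneq V(L(G))$ with $|S| \leq \left\lceil \frac{\min\{\delta(G),\kappa(L(G))\}}{2} \right\rceil$, the graph $L(G)-S$ has $\left\lfloor \frac{\min\{\delta(G),\kappa(L(G))\}}{2} \right\rfloor$ completely independent spanning trees. Moreover, if $G$ is not super edge-connected, then for any $S \subsetneq V(L(G))$ with $|S| \leq \left\lceil \frac{\kappa(L(G))}{2} \right\rceil$, the graph $L(G)-S$ has $\left\lfloor \frac{\kappa(L(G))}{2} \right\rfloor$ completely independent spanning trees.
   Context: All graphs are finite, simple and undirected. $L(G)$ is the line graph of $G$ (vertex set $E(G)$, two vertices adjacent iff the corresponding edges share an endpoint). $\delta(G)$ is the minimum degree of $G$ and $\kappa(H)$ the (vertex) connectivity of $H$. $L(G)-S$ is obtained by deleting the vertices in $S$. An edge-cut of a connected graph is a set of edges whose removal disconnects it; a connected graph is super edge-connected if every minimum edge-cut isolates a vertex. Spanning trees $T_1,\dots,T_k$ of a graph $H$ are completely independent if for any two distinct vertices $u,v$ of $H$, the $u$–$v$ paths in $T_1,\dots,T_k$ are pairwise edge-disjoint and pairwise share no vertex other than $u$ and $v$ (having $0$ such trees is vacuous). -}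

module Defs where

open import Data.Nat using (ℕ; _≤_; _≥_)
open import Data.Fin using (Fin)
import Data.Fin as Fin
open import Data.Bool using (Bool; true; false)
import Data.Bool as Bool
open import Data.List using (List; []; _∷_; length; filter; allFin)
open import Data.List.Membership.Propositional using (_∈_; _∉_)
open import Data.List.Relation.Unary.Any using (Any)
open import Data.List.Relation.Unary.Unique.Propositional using (Unique)
open import Data.Product using (Σ; ∃; _×_; _,_; proj₁; proj₂)
open import Data.Sum using (_⊎_; inj₁; inj₂)
open import Data.Empty using (⊥)
open import Relation.Nullary using (¬_)
open import Relation.Binary.PropositionalEquality using (_≡_; _≢_; refl; sym; trans; subst)
open import Relation.Binary.Construct.Closure.ReflexiveTransitive using (Star)

record Graph : Set₁ where
  field
    V       : Set
    Adj     : V → V → Set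
    Adj-sym : ∀ {u v} → Adj u v → Adj v u
    Adj-irr : ∀ {v} → ¬ Adj v v
open Graph public

Connected : Graph → Set
Connected H = V H × (∀ u v → Star (Adj H) u v)

_─_ : (H : Graph) → List (V H) → Graph
H ─ S = record
  { V       = Σ (V H) (λ v → v ∉ S)
  ; Adj     = λ u v → Adj H (proj₁ u) (proj₁ v)
  ; Adj-sym = Adj-sym H
  ; Adj-irr = Adj-irr H
  }

module _ {A : Set} (R : A → A → Set) where

  data Walk : A → A → Set where
    nil  : ∀ {u} → Walk u u
    cons : ∀ {u w v} → R u w → Walk w v → Walk u v

  vertices : ∀ {u v} → Walk u v → List A
  vertices {u} nil        = u ∷ []
  vertices {u} (cons _ p) = u ∷ vertices p

  edges : ∀ {u v} → Walk u v → List (A × A)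
  edges nil                  = []
  edges {u} (cons {w = w} _ p) = (u , w) ∷ edges p

  IsPath : ∀ {u v} → Walk u v → Set
  IsPath p = Unique (vertices p)

  Acyclic : Set
  Acyclic = ∀ {u w} (p : Walk u w) → IsPath p → length (vertices p) ≥ 3 → ¬ R w u

record SpanningTree (H : Graph) : Set₁ where
  field
    TAdj     : V H → V H → Set
    TAdj-sub : ∀ {u v} → TAdj u v → Adj H u v
    TAdj-sym : ∀ {u v} → TAdj u v → TAdj v u
    T-conn   : V H × (∀ u v → Star TAdj u v)
    T-acyc   : Acyclic TAdj
open SpanningTree public

PathsIndependent : {A : Set} {R R' : A → A → Set} {u v : A} →
                   Walk R u v → Walk R' u v → Set
PathsIndependent {A} {R} {R'} {u} {v} p q =
  (∀ a b → (a , b) ∈ edges R p → ((a , b) ∉ edges R' q × (b , a) ∉ edges R' q))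
  × (∀ x → x ∈ vertices R p → x ∈ vertices R' q → (x ≡ u ⊎ x ≡ v))

CompletelyIndependent : (H : Graph) (k : ℕ) → (Fin k → SpanningTree H) → Set
CompletelyIndependent H k T =
  ∀ i j → i ≢ j → ∀ u v → u ≢ v →
  ∀ (p : Walk (TAdj (T i)) u v) (q : Walk (TAdj (T j)) u v) →
  IsPath (TAdj (T i)) p → IsPath (TAdj (T j)) q → PathsIndependent p q

HasCISTs : Graph → ℕ → Set₁
HasCISTs H k = Σ (Fin k → SpanningTree H) (CompletelyIndependent H k)

Separating : (H : Graph) → List (V H) → Set
Separating H S = ¬ Connected (H ─ S) ⊎ (∀ (x y : V (H ─ S)) → x ≡ y)

IsConnectivity : Graph → ℕ → Set
IsConnectivity H k =
  (∃ λ S → Unique S × Separating H S × length S ≡ k)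
  × (∀ S → Unique S → Separating H S → k ≤ length S)

record FinGraph (n : ℕ) : Set where
  field
    adj     : Fin n → Fin n → Bool
    adj-sym : ∀ i j → adj i j ≡ adj j i
    adj-irr : ∀ i → adj i i ≡ false
open FinGraph public

adj-irr′ : ∀ {n} (G : FinGraph n) {i} → ¬ adj G i i ≡ true
adj-irr′ G {i} e with trans (sym (adj-irr G i)) e
... | ()

toGraph : ∀ {n} → FinGraph n → Graph
toGraph {n} G = record
  { V       = Fin n
  ; Adj     = λ i j → adj G i j ≡ true
  ; Adj-sym = λ {i} {j} e → trans (adj-sym G j i) e
  ; Adj-irr = adj-irr′ G
  }

degree : ∀ {n} → FinGraph n → Fin n → ℕ
degree {n} G i = length (filter (λ j → adj G i j Bool.≟ true) (allFin n))

IsMinDegree : ∀ {n} → FinGraph n → ℕ → Set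
IsMinDegree G d = (∃ λ i → degree G i ≡ d) × (∀ i → d ≤ degree G i)

-- edges of G, each stored once with its endpoints in increasing order
record Edge {n} (G : FinGraph n) : Set where
  constructor edge
  field
    end₁ : Fin n
    end₂ : Fin n
    ord  : end₁ Fin.< end₂
    isE  : adj G end₁ end₂ ≡ true
open Edge public

ShareEnd : ∀ {n} {G : FinGraph n} → Edge G → Edge G → Set
ShareEnd e f = (end₁ e ≡ end₁ f ⊎ end₁ e ≡ end₂ f) ⊎ (end₂ e ≡ end₁ f ⊎ end₂ e ≡ end₂ f)

ShareEnd-sym : ∀ {n} {G : FinGraph n} {e f : Edge G} → ShareEnd e f → ShareEnd f e
ShareEnd-sym (inj₁ (inj₁ x)) = inj₁ (inj₁ (sym x))
ShareEnd-sym (inj₁ (inj₂ x)) = inj₂ (inj₁ (sym x))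
ShareEnd-sym (inj₂ (inj₁ x)) = inj₁ (inj₂ (sym x))
ShareEnd-sym (inj₂ (inj₂ x)) = inj₂ (inj₂ (sym x))

LineGraph : ∀ {n} → FinGraph n → Graph
LineGraph G = record
  { V       = Edge G
  ; Adj     = λ e f → e ≢ f × ShareEnd e f
  ; Adj-sym = λ { {e} {f} (ne , s) → (λ eq → ne (sym eq)) , ShareEnd-sym {G = G} {e} {f} s }
  ; Adj-irr = λ { (ne , _) → ne refl }
  }

EdgeIn : ∀ {n} {G : FinGraph n} → List (Edge G) → Fin n → Fin n → Set
EdgeIn F u v = Any (λ e → (end₁ e ≡ u × end₂ e ≡ v) ⊎ (end₁ e ≡ v × end₂ e ≡ u)) F

removeEdges : ∀ {n} (G : FinGraph n) → List (Edge G) → Graph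
removeEdges {n} G F = record
  { V       = Fin n
  ; Adj     = λ u v → (adj G u v ≡ true) × ¬ EdgeIn F u v
  ; Adj-sym = λ { {u} {v} (a , ni) → trans (adj-sym G v u) a , λ x → ni (flipIn x) }
  ; Adj-irr = λ { (a , _) → adj-irr′ G a }
  }
  where
  flipIn : ∀ {F : List (Edge G)} {u v} → EdgeIn F v u → EdgeIn F u v
  flipIn (Any.here (inj₁ (a , b))) = Any.here (inj₂ (a , b))
  flipIn (Any.here (inj₂ (a , b))) = Any.here (inj₁ (a , b))
  flipIn (Any.there x)             = Any.there (flipIn x)

IsEdgeCut : ∀ {n} (G : FinGraph n) → List (Edge G) → Set
IsEdgeCut G F = Unique F × ¬ Connected (removeEdges G F)

IsMinEdgeCut : ∀ {n} (G : FinGraph n) → List (Edge G) → Set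
IsMinEdgeCut G F = IsEdgeCut G F × (∀ F′ → IsEdgeCut G F′ → length F ≤ length F′)

Isolates : ∀ {n} (G : FinGraph n) → List (Edge G) → Set
Isolates G F = ∃ λ v → ∀ (e : Edge G) → (end₁ e ≡ v ⊎ end₂ e ≡ v) → e ∈ F

SuperEdgeConnected : ∀ {n} → FinGraph n → Set
SuperEdgeConnected G =
  Connected (toGraph G) × (∀ F → IsMinEdgeCut G F → Isolates G F)

{-# OPTIONS --safe #-}
module Submission where

-- An edge cut that isolates no vertex separates L(G). So every edge cut has at least d edges, where d = min(δ, κ(L(G)))
-- or, if some minimum cut isolates no vertex, d = κ(L(G)). Counting boundaries, every partition of the vertices
-- into p ≥ 2 classes is crossed by at least pd/2 edges, hence by at least ⌊d/2⌋(p − 1) edges outside S; by the theorem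
-- of Nash-Williams and Tutte, proved here with shortest augmenting paths, G − S contains ⌊d/2⌋ edge-disjoint spanning
-- trees. Root them at a common vertex. The i-th tree of L(G) − S has the edges of the i-th tree as its inner vertices,
-- and attaches an edge e to the i-th parent edge of one end of e, the head of e. For an edge of a spanning tree the
-- head is its upper end, except that one fixed edge at the root has its lower end as head. Then no two edges of
-- different trees are attached to each other, so the trees of L(G) − S are edge-disjoint.

open import Defs
open import Algebra.Properties.CommutativeSemigroup using (interchange)
open import Data.Bool using (true)
import Data.Bool.Properties as Bool
open import Data.Empty using (⊥; ⊥-elim)
open import Data.Fin as Fin using (Fin)
import Data.Fin.Properties as Fin
open import Data.List using (List; []; _∷_; _++_; length; filter; lookup; tabulate; allFin; concatMap; deduplicate)
import Data.List.Membership.DecPropositional as DecMembership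
open import Data.List.Membership.Propositional using (_∈_; _∉_)
open import Data.List.Membership.Propositional.Properties
open import Data.List.Properties using (length-++; length-tabulate)
import Data.List.Relation.Unary.All as All
open import Data.List.Relation.Unary.AllPairs using ([]; _∷_)
import Data.List.Relation.Unary.Any as Any
open import Data.List.Relation.Unary.Any using (here; there)
import Data.List.Relation.Unary.Any.Properties as Any
open import Data.List.Relation.Unary.Unique.DecPropositional.Properties using (deduplicate-!)
open import Data.List.Relation.Unary.Unique.Propositional using (Unique)
import Data.List.Relation.Unary.Unique.Propositional.Properties as Unique
open import Data.Maybe using (Maybe; just; nothing; maybe′)
import Data.Maybe.Properties as Maybe
open import Data.Nat
open import Data.Nat.Properties
open import Data.Nat.Tactic.RingSolver using (solve-∀)
open import Data.Product using (∃; _×_; _,_; proj₁; proj₂)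
open import Data.Sum as Sum using (_⊎_; inj₁; inj₂; [_,_]; swap)
open import Data.Unit using (⊤; tt)
open import Function using (_∘_; id)
open import Relation.Binary.Construct.Closure.ReflexiveTransitive as Star using (Star; ε; _◅_; _◅◅_)
open import Relation.Binary.Definitions using (DecidableEquality; tri<; tri≈; tri>)
open import Relation.Binary.PropositionalEquality hiding ([_])
import Relation.Binary.PropositionalEquality.WithK as WithK
open import Relation.Nullary using (¬_; Dec; yes; no; contradiction)
open import Relation.Nullary.Decidable using (decidable-stable; _×-dec_; _⊎-dec_; ¬?)
open import Relation.Unary using (Decidable; _⊆_)

private variable
  A B : Set
  P : A → Set

-- Counting

∑ : List A → (A → ℕ) → ℕ
∑ []       f = 0
∑ (x ∷ xs) f = f x + ∑ xs f

𝟙 : {P : Set} → Dec P → ℕ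
𝟙 (yes _) = 1
𝟙 (no _)  = 0

𝟙-mono : {P Q : Set} (P? : Dec P) (Q? : Dec Q) → (P → Q) → 𝟙 P? ≤ 𝟙 Q?
𝟙-mono (no _)  _       f = z≤n
𝟙-mono (yes _) (yes _) f = ≤-refl
𝟙-mono (yes p) (no ¬q) f = ⊥-elim (¬q (f p))

𝟙-< : {P Q : Set} (P? : Dec P) (Q? : Dec Q) → ¬ P → Q → 𝟙 P? < 𝟙 Q?
𝟙-< (yes p) _       ¬p q = ⊥-elim (¬p p)
𝟙-< (no _)  (yes _) ¬p q = ≤-refl
𝟙-< (no _)  (no ¬q) ¬p q = ⊥-elim (¬q q)

𝟙-⊎ : {P Q R : Set} (P? : Dec P) (Q? : Dec Q) (R? : Dec R) → (P → Q ⊎ R) → 𝟙 P? ≤ 𝟙 Q? + 𝟙 R?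
𝟙-⊎ (no _)  _       _       f = z≤n
𝟙-⊎ (yes _) (yes _) _       f = s≤s z≤n
𝟙-⊎ (yes _) (no _)  (yes _) f = ≤-refl
𝟙-⊎ (yes p) (no ¬q) (no ¬r) f = ⊥-elim ([ ¬q , ¬r ] (f p))

∑-mono : ∀ (xs : List A) {f g} → (∀ x → f x ≤ g x) → ∑ xs f ≤ ∑ xs g
∑-mono []       h = z≤n
∑-mono (x ∷ xs) h = +-mono-≤ (h x) (∑-mono xs h)

∑-cong : ∀ (xs : List A) {f g} → (∀ x → f x ≡ g x) → ∑ xs f ≡ ∑ xs g
∑-cong []       h = refl
∑-cong (x ∷ xs) h = cong₂ _+_ (h x) (∑-cong xs h)

∑-+ : ∀ (xs : List A) f g → ∑ xs (λ x → f x + g x) ≡ ∑ xs f + ∑ xs g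
∑-+ []       f g = refl
∑-+ (x ∷ xs) f g = trans (cong (f x + g x +_) (∑-+ xs f g)) (interchange +-commutativeSemigroup (f x) (g x) _ _)

∑-*ˡ : ∀ (xs : List A) c f → ∑ xs (λ x → c * f x) ≡ c * ∑ xs f
∑-*ˡ []       c f = sym (*-zeroʳ c)
∑-*ˡ (x ∷ xs) c f = trans (cong (c * f x +_) (∑-*ˡ xs c f)) (sym (*-distribˡ-+ c (f x) _))

∑-0 : ∀ (xs : List A) → ∑ xs (λ _ → 0) ≡ 0
∑-0 []       = refl
∑-0 (x ∷ xs) = ∑-0 xs

∑-const : ∀ (xs : List A) c → ∑ xs (λ _ → c) ≡ length xs * c
∑-const []       c = refl
∑-const (x ∷ xs) c = cong (c +_) (∑-const xs c)

∑-swap : ∀ (xs : List A) (ys : List B) (f : A → B → ℕ) →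
         ∑ xs (λ x → ∑ ys (f x)) ≡ ∑ ys (λ y → ∑ xs (λ x → f x y))
∑-swap []       ys f = sym (∑-0 ys)
∑-swap (x ∷ xs) ys f = trans (cong (∑ ys (f x) +_) (∑-swap xs ys f)) (sym (∑-+ ys (f x) _))

∑-mono-< : ∀ {xs : List A} {f g x} → (∀ x → f x ≤ g x) → x ∈ xs → f x < g x → ∑ xs f < ∑ xs g
∑-mono-< {xs = _ ∷ xs} h (here refl) lt = +-mono-<-≤ lt (∑-mono xs h)
∑-mono-< {xs = y ∷ xs} h (there x∈)  lt = +-mono-≤-< (h y) (∑-mono-< h x∈ lt)

term≤∑ : ∀ {xs : List A} f {x} → x ∈ xs → f x ≤ ∑ xs f
term≤∑ f (here refl)           = m≤m+n _ _
term≤∑ {xs = y ∷ xs} f (there x∈) = ≤-trans (term≤∑ f x∈) (m≤n+m _ (f y))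

∑-tabulate : ∀ {m} (h : Fin m → A) (f : A → ℕ) → ∑ (tabulate h) f ≡ ∑ (allFin m) (f ∘ h)
∑-tabulate {m = zero}  h f = refl
∑-tabulate {m = suc m} h f = cong (f (h Fin.zero) +_)
  (trans (∑-tabulate (h ∘ Fin.suc) f) (sym (∑-tabulate Fin.suc (f ∘ h))))

∑-lookup : ∀ (xs : List A) f → ∑ (allFin (length xs)) (f ∘ lookup xs) ≡ ∑ xs f
∑-lookup []       f = refl
∑-lookup (x ∷ xs) f = cong (f x +_) (trans (∑-tabulate Fin.suc (f ∘ lookup (x ∷ xs))) (∑-lookup xs f))

length-filter : (P? : Decidable P) (xs : List A) → length (filter P? xs) ≡ ∑ xs (𝟙 ∘ P?)
length-filter P? []       = refl
length-filter P? (x ∷ xs) with P? x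
... | yes _ = cong suc (length-filter P? xs)
... | no  _ = length-filter P? xs

∑-filter : (P? : Decidable P) (xs : List A) (f : A → ℕ) → ∑ (filter P? xs) f ≡ ∑ xs (λ x → 𝟙 (P? x) * f x)
∑-filter P? []       f = refl
∑-filter P? (x ∷ xs) f with P? x
... | yes _ = cong₂ _+_ (sym (+-identityʳ (f x))) (∑-filter P? xs f)
... | no  _ = ∑-filter P? xs f

∑-𝟙-≢ : (_≟_ : DecidableEquality A) (x : A) {xs : List A} → x ∉ xs → ∑ xs (λ y → 𝟙 (y ≟ x)) ≡ 0
∑-𝟙-≢ _≟_ x {[]}     x∉ = refl
∑-𝟙-≢ _≟_ x {y ∷ xs} x∉ with y ≟ x
... | yes refl = ⊥-elim (x∉ (here refl))
... | no _     = ∑-𝟙-≢ _≟_ x (x∉ ∘ there)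

∑-𝟙-≡ : (_≟_ : DecidableEquality A) {x : A} {xs : List A} → Unique xs → x ∈ xs → ∑ xs (λ y → 𝟙 (y ≟ x)) ≡ 1
∑-𝟙-≡ _≟_ {x} {y ∷ xs} (y∉ ∷ u) x∈ with y ≟ x
... | yes refl = cong suc (∑-𝟙-≢ _≟_ x (λ x∈xs → All.lookup y∉ x∈xs refl))
∑-𝟙-≡ _≟_ {x} {y ∷ xs} (y∉ ∷ u) (here refl) | no y≢x = ⊥-elim (y≢x refl)
∑-𝟙-≡ _≟_ {x} {y ∷ xs} (y∉ ∷ u) (there x∈)  | no _   = ∑-𝟙-≡ _≟_ u x∈

-- By `inj` no two distinct entries share a partner, so deleting a partner of the first entry from
-- `ys` leaves partners for all the others.
length-≤ : (R : A → B → Set) → (∀ {x x′ y} → R x y → R x′ y → x ≡ x′) →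
           ∀ {xs ys} → Unique xs → (∀ {x} → x ∈ xs → ∃ λ y → y ∈ ys × R x y) → length xs ≤ length ys
length-≤ R inj {[]}     u h = z≤n
length-≤ R inj {x ∷ xs} {ys} (x∉ ∷ u) h with h (here refl)
... | y , y∈ , r with ∈-∃++ y∈
... | ys₁ , ys₂ , refl = subst (suc (length xs) ≤_) eq (s≤s (length-≤ R inj u h′))
  where
  eq : suc (length (ys₁ ++ ys₂)) ≡ length (ys₁ ++ y ∷ ys₂)
  eq = trans (cong suc (length-++ ys₁)) (trans (sym (+-suc (length ys₁) _)) (sym (length-++ ys₁)))
  h′ : ∀ {z} → z ∈ xs → ∃ λ w → w ∈ ys₁ ++ ys₂ × R z w
  h′ z∈ with h (there z∈)
  ... | w , w∈ , s with ∈-++⁻ ys₁ w∈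
  ... | inj₁ w∈₁         = w , ∈-++⁺ˡ w∈₁ , s
  ... | inj₂ (there w∈₂) = w , ∈-++⁺ʳ ys₁ w∈₂ , s
  ... | inj₂ (here refl) = ⊥-elim (All.lookup x∉ z∈ (inj r s))

lookup-injective : ∀ {xs : List A} → Unique xs → ∀ {i j} → lookup xs i ≡ lookup xs j → i ≡ j
lookup-injective {xs = _ ∷ _}  _        {Fin.zero}  {Fin.zero}  _  = refl
lookup-injective {xs = _ ∷ xs} (x∉ ∷ _) {Fin.zero}  {Fin.suc j} eq = ⊥-elim (All.lookup x∉ (∈-lookup j) eq)
lookup-injective {xs = _ ∷ xs} (x∉ ∷ _) {Fin.suc i} {Fin.zero}  eq = ⊥-elim (All.lookup x∉ (∈-lookup i) (sym eq))
lookup-injective {xs = _ ∷ _}  (_ ∷ u)  {Fin.suc i} {Fin.suc j} eq = cong Fin.suc (lookup-injective u eq)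

-- For idempotent f the classes of the kernel of f are counted by the fixed points of f.
classes : ∀ {n} → (Fin n → Fin n) → ℕ
classes {n} f = ∑ (allFin n) (λ v → 𝟙 (f v Fin.≟ v))

classes-1 : ∀ {n} (f : Fin n → Fin n) → (∀ v → f (f v) ≡ f v) → Fin n → 1 ≤ classes f
classes-1 f idem v = ≤-trans (𝟙-mono (yes (idem v)) (f (f v) Fin.≟ f v) id)
                             (term≤∑ (λ v → 𝟙 (f v Fin.≟ v)) (∈-allFin (f v)))

classes-2 : ∀ {n} (f : Fin n → Fin n) → (∀ v → f (f v) ≡ f v) → ∀ {u v} → f u ≢ f v → 2 ≤ classes f
classes-2 {n} f idem {u} {v} ne = subst (2 ≤_) (length-filter fix? (allFin n))
  (length-≤ _≡_ (λ p q → trans p (sym q)) ((ne All.∷ All.[]) ∷ (All.[] ∷ []))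
    λ { (here refl) → f u , ∈-filter⁺ fix? (∈-allFin _) (idem u) , refl
      ; (there (here refl)) → f v , ∈-filter⁺ fix? (∈-allFin _) (idem v) , refl })
  where fix? = λ v → f v Fin.≟ v

-- Connectivity in a multigraph given by the two ends of each edge

module Multigraph {n m : ℕ} (a b : Fin m → Fin n) where

  Joins : Fin m → Fin n → Fin n → Set
  Joins e u v = (a e ≡ u × b e ≡ v) ⊎ (a e ≡ v × b e ≡ u)

  Step : (Fin m → Set) → Fin n → Fin n → Set
  Step P u v = ∃ λ e → P e × Joins e u v

  Conn : (Fin m → Set) → Fin n → Fin n → Set
  Conn P = Star (Step P)

  Ends : (Fin m → Set) → Fin m → Set
  Ends P e = Conn P (a e) (b e)

  step-sym : ∀ {P u v} → Step P u v → Step P v u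
  step-sym (e , p , j) = e , p , swap j

  conn-sym : ∀ {P u v} → Conn P u v → Conn P v u
  conn-sym = Star.reverse step-sym

  ends : ∀ {P : Fin m → Set} e → P e → Ends P e
  ends e p = (e , p , inj₁ (refl , refl)) ◅ ε

  conn-bind : ∀ {P Q : Fin m → Set} → P ⊆ Ends Q → ∀ {u v} → Conn P u v → Conn Q u v
  conn-bind f ε = ε
  conn-bind f ((e , p , inj₁ (refl , refl)) ◅ c) = f p ◅◅ conn-bind f c
  conn-bind f ((e , p , inj₂ (refl , refl)) ◅ c) = conn-sym (f p) ◅◅ conn-bind f c

  conn-mono : ∀ {P Q : Fin m → Set} → P ⊆ Q → ∀ {u v} → Conn P u v → Conn Q u v
  conn-mono f = conn-bind (λ {e} p → ends e (f p))

  -- A walk cut at its first and last use of `g`. If it leaves `g` at the end where it first came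
  -- in, `conn-split` drops the part between.
  Through : (Fin m → Set) → Fin m → Fin n → Fin n → Set
  Through Q g u v = (Conn Q u (a g) × Conn Q (b g) v) ⊎ (Conn Q u (b g) × Conn Q (a g) v)

  conn-split : ∀ {P Q : Fin m → Set} g → (∀ {e} → P e → Q e ⊎ e ≡ g) →
               ∀ {u v} → Conn P u v → Conn Q u v ⊎ Through Q g u v
  conn-split g f ε = inj₁ ε
  conn-split {P} {Q} g f ((e , p , j) ◅ c) = go (f p) j (conn-split g f c)
    where
    go : ∀ {u w v} → Q e ⊎ e ≡ g → Joins e u w → Conn Q w v ⊎ Through Q g w v → Conn Q u v ⊎ Through Q g u v
    go (inj₁ q) j (inj₁ c)                = inj₁ ((e , q , j) ◅ c)
    go (inj₁ q) j (inj₂ (inj₁ (c , d)))   = inj₂ (inj₁ ((e , q , j) ◅ c , d))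
    go (inj₁ q) j (inj₂ (inj₂ (c , d)))   = inj₂ (inj₂ ((e , q , j) ◅ c , d))
    go (inj₂ refl) (inj₁ (refl , refl)) (inj₁ c)              = inj₂ (inj₁ (ε , c))
    go (inj₂ refl) (inj₁ (refl , refl)) (inj₂ (inj₁ (c , d))) = inj₂ (inj₁ (ε , d))
    go (inj₂ refl) (inj₁ (refl , refl)) (inj₂ (inj₂ (c , d))) = inj₁ d
    go (inj₂ refl) (inj₂ (refl , refl)) (inj₁ c)              = inj₂ (inj₂ (ε , c))
    go (inj₂ refl) (inj₂ (refl , refl)) (inj₂ (inj₁ (c , d))) = inj₁ d
    go (inj₂ refl) (inj₂ (refl , refl)) (inj₂ (inj₂ (c , d))) = inj₂ (inj₂ (ε , d))

  -- The two pieces of the walk and the detour from `u` to `v` close up to a cycle through `g`. With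
  -- `g` not in `R` this contradicts acyclicity.
  through-ends : ∀ {Q R : Fin m → Set} g {u v} → Q ⊆ R → Through Q g u v → Conn R u v → Ends R g
  through-ends g f (inj₁ (c , d)) r = conn-sym (conn-mono f c) ◅◅ r ◅◅ conn-sym (conn-mono f d)
  through-ends g f (inj₂ (c , d)) r = conn-mono f d ◅◅ conn-sym r ◅◅ conn-mono f c

  -- Representatives of components: a new edge `e` merges the class of `a e` into that of `b e`. The
  -- map is idempotent, as `classes` wants.
  comp : List (Fin m) → Fin n → Fin n
  comp []      v = v
  comp (e ∷ L) v with comp L v Fin.≟ comp L (a e)
  ... | yes _ = comp L (b e)
  ... | no  _ = comp L v

  comp-conn : ∀ L v → Conn (_∈ L) v (comp L v)
  comp-conn []      v = ε
  comp-conn (e ∷ L) v with comp L v Fin.≟ comp L (a e)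
  ... | no  _  = conn-mono there (comp-conn L v)
  ... | yes eq = conn-mono there (comp-conn L v)
              ◅◅ subst (λ w → Conn (_∈ e ∷ L) w (a e)) (sym eq) (conn-sym (conn-mono there (comp-conn L (a e))))
              ◅◅ ends e (here refl)
              ◅◅ conn-mono there (comp-conn L (b e))

  comp-∷ : ∀ e L {u v} → comp L u ≡ comp L v → comp (e ∷ L) u ≡ comp (e ∷ L) v
  comp-∷ e L {u} {v} eq with comp L u Fin.≟ comp L (a e) | comp L v Fin.≟ comp L (a e)
  ... | yes _ | yes _ = refl
  ... | yes p | no ¬q = ⊥-elim (¬q (trans (sym eq) p))
  ... | no ¬p | yes q = ⊥-elim (¬p (trans eq q))
  ... | no _  | no _  = eq

  comp-ends : ∀ {e} L → e ∈ L → comp L (a e) ≡ comp L (b e)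
  comp-ends (e ∷ L) (there e∈)  = comp-∷ e L (comp-ends L e∈)
  comp-ends (e ∷ L) (here refl) with comp L (a e) Fin.≟ comp L (a e)
  ... | no ¬p = ⊥-elim (¬p refl)
  ... | yes _ with comp L (b e) Fin.≟ comp L (a e)
  ...   | yes _ = refl
  ...   | no _  = refl

  conn-comp : ∀ L {u v} → Conn (_∈ L) u v → comp L u ≡ comp L v
  conn-comp L ε = refl
  conn-comp L ((e , e∈ , inj₁ (refl , refl)) ◅ c) = trans (comp-ends L e∈) (conn-comp L c)
  conn-comp L ((e , e∈ , inj₂ (refl , refl)) ◅ c) = trans (sym (comp-ends L e∈)) (conn-comp L c)

  comp⇒conn : ∀ L {u v} → comp L u ≡ comp L v → Conn (_∈ L) u v
  comp⇒conn L {u} {v} eq = comp-conn L u ◅◅ subst (λ w → Conn (_∈ L) w v) (sym eq) (conn-sym (comp-conn L v))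

  comp-idem : ∀ L v → comp L (comp L v) ≡ comp L v
  comp-idem L v = sym (conn-comp L (comp-conn L v))

  conn? : ∀ {P : Fin m → Set} → Decidable P → ∀ u v → Dec (Conn P u v)
  conn? P? u v with comp L u Fin.≟ comp L v
    where L = filter P? (allFin m)
  ... | yes eq = yes (conn-mono (λ e∈ → proj₂ (∈-filter⁻ P? {xs = allFin m} e∈)) (comp⇒conn (filter P? (allFin m)) eq))
  ... | no ¬eq = no (λ c → ¬eq (conn-comp _ (conn-mono (λ {e} p → ∈-filter⁺ P? (∈-allFin e) p) c)))

  -- The old representative of `a e` is the only fixed point that is lost, since its class now takes
  -- the representative of `b e`.
  classes-∷ : ∀ e L → comp L (a e) ≢ comp L (b e) → suc (classes (comp (e ∷ L))) ≡ classes (comp L)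
  classes-∷ e L ne = begin
    suc (classes (comp (e ∷ L)))
      ≡⟨ cong (_+ classes (comp (e ∷ L))) (sym (∑-𝟙-≡ Fin._≟_ (Unique.allFin⁺ n) (∈-allFin x))) ⟩
    ∑ (allFin n) (λ v → 𝟙 (v Fin.≟ x)) + classes (comp (e ∷ L))
      ≡⟨ sym (∑-+ (allFin n) _ _) ⟩
    ∑ (allFin n) (λ v → 𝟙 (v Fin.≟ x) + 𝟙 (comp (e ∷ L) v Fin.≟ v))
      ≡⟨ ∑-cong (allFin n) point ⟩
    classes (comp L) ∎
    where
    open ≡-Reasoning
    x = comp L (a e)
    y = comp L (b e)
    point : ∀ v → 𝟙 (v Fin.≟ x) + 𝟙 (comp (e ∷ L) v Fin.≟ v) ≡ 𝟙 (comp L v Fin.≟ v)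
    point v with v Fin.≟ x
    point v | no v≢x with comp L v Fin.≟ x
    ... | no _ = refl
    ... | yes eq with y Fin.≟ v | comp L v Fin.≟ v
    ...   | no _    | no _   = refl
    ...   | _       | yes eq′ = ⊥-elim (v≢x (trans (sym eq′) eq))
    ...   | yes y≡v | no _   = ⊥-elim (ne (trans (sym eq) (trans (cong (comp L) (sym y≡v)) (comp-idem L (b e)))))
    point v | yes refl with comp L x Fin.≟ x
    ... | no ¬p = ⊥-elim (¬p (comp-idem L (a e)))
    ... | yes _ with y Fin.≟ x
    ...   | yes y≡x = ⊥-elim (ne (sym y≡x))
    ...   | no _    = refl

-- Packing spanning trees

module Packing {n m k : ℕ} (a b : Fin m → Fin n) where
  open Multigraph a b

  Colouring : Set
  Colouring = Fin m → Maybe (Fin k)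

  Class : Colouring → Fin k → Fin m → Set
  Class col i e = col e ≡ just i

  class? : ∀ col i → Decidable (Class col i)
  class? col i e = Maybe.≡-dec Fin._≟_ (col e) (just i)

  uncoloured? : ∀ (col : Colouring) e → Dec (col e ≡ nothing)
  uncoloured? col e = Maybe.≡-dec Fin._≟_ (col e) nothing

  _∖_ : (Fin m → Set) → Fin m → Fin m → Set
  (P ∖ g) e = P e × e ≢ g

  Forests : Colouring → Set
  Forests col = ∀ e i → col e ≡ just i → ¬ Ends (Class col i ∖ e) e

  Addable : Colouring → Fin m → Fin k → Set
  Addable col e i = ¬ Ends (Class col i) e

  ends? : ∀ {P : Fin m → Set} → Decidable P → Decidable (Ends P)
  ends? P? e = conn? P? (a e) (b e)

  -- f lies on the cycle that e closes in the forest containing f.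
  record Arc (col : Colouring) (e f : Fin m) : Set where
    constructor arc
    field
      colour : Fin k
      member : col f ≡ just colour
      joined : Ends (Class col colour) e
      cut    : ¬ Ends (Class col colour ∖ f) e

  arc? : ∀ col e f → Dec (Arc col e f)
  arc? col e f with col f in eq
  ... | nothing = no λ { (arc i mem _ _) → contradiction (trans (sym eq) mem) λ () }
  ... | just i with ends? (class? col i) e | ends? (λ x → class? col i x ×-dec ¬? (x Fin.≟ f)) e
  ...   | no ¬c | _     = no λ { (arc j mem c _) → ¬c (subst (λ j → Ends (Class col j) e) (Maybe.just-injective (trans (sym mem) eq)) c) }
  ...   | yes _ | yes d = no λ { (arc j mem _ x) → x (subst (λ j → Ends (Class col j ∖ f) e) (Maybe.just-injective (trans (sym eq) mem)) d) }
  ...   | yes c | no ¬d = yes (arc i eq c ¬d)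

  -- An exchange path of matroid union: each arc leads from an edge to one that it could replace in
  -- the class of the latter.
  data Path (col : Colouring) : Fin m → ℕ → Set where
    start : ∀ {e} → col e ≡ nothing → Path col e 0
    step  : ∀ {e f l} → Path col e l → Arc col e f → Path col f (suc l)

  Before : ∀ {col} → (Fin m → Set) → ∀ {e l} → Path col e l → Set
  Before P (start _)        = ⊤
  Before P (step {e} π _) = P e × Before P π

  scan : ∀ {col} {D : Fin m → Set} → Decidable D → ∀ {e l} (π : Path col e l) →
         (∃ λ e′ → ∃ λ l′ → l′ < l × Path col e′ l′ × D e′) ⊎ Before (λ e′ → ¬ D e′) π
  scan D? (start _) = inj₂ tt
  scan D? (step {e} {l = l} π _) with D? e
  ... | yes d = inj₁ (e , l , ≤-refl , π , d)
  ... | no ¬d with scan D? π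
  ...   | inj₁ (e′ , l′ , lt , rest) = inj₁ (e′ , l′ , m<n⇒m<1+n lt , rest)
  ...   | inj₂ bef                   = inj₂ (¬d , bef)

  recolour : Fin m → Fin k → Colouring → Colouring
  recolour g c col e with e Fin.≟ g
  ... | yes _ = just c
  ... | no  _ = col e

  module _ {g : Fin m} {c : Fin k} {col : Colouring} where

    recolour-≢ : ∀ {e} → e ≢ g → recolour g c col e ≡ col e
    recolour-≢ {e} ne with e Fin.≟ g
    ... | yes eq = ⊥-elim (ne eq)
    ... | no _   = refl

    recolour-old : ∀ {q e} → q ≢ c → Class (recolour g c col) q e → (Class col q ∖ g) e
    recolour-old {e = e} q≢c p with e Fin.≟ g
    ... | yes _ = ⊥-elim (q≢c (sym (Maybe.just-injective p)))
    ... | no ne = p , ne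

    recolour-new : ∀ {e} → Class (recolour g c col) c e → Class col c e ⊎ e ≡ g
    recolour-new {e} p with e Fin.≟ g
    ... | yes eq = inj₂ eq
    ... | no _   = inj₁ p

    -- A fundamental cycle that g does not close cannot run through g.
    recolour-cut : ∀ {x e} → Addable col g c → Ends (Class col c) x → ¬ Ends (Class col c ∖ e) x →
                   ¬ Ends (Class (recolour g c col) c ∖ e) x
    recolour-cut {x} {e} add con ¬cut c′
      with conn-split {Q = Class col c ∖ e} g (λ { (p , ne) → Sum.map₁ (_, ne) (recolour-new p) }) c′
    ... | inj₁ d = ¬cut d
    ... | inj₂ t = add (through-ends g proj₁ t con)

    -- Adding `g` to class `c` closes no cycle there, and every other class can only lose `g`.
    recolour-forests : Forests col → Addable col g c → Forests (recolour g c col)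
    recolour-forests F add e q p with e Fin.≟ g
    ... | yes refl rewrite sym (Maybe.just-injective p) = λ c′ → add (conn-mono (λ { (p , ne) → [ id , ⊥-elim ∘ ne ] (recolour-new p) }) c′)
    ... | no ne with q Fin.≟ c
    ...   | yes refl = recolour-cut add (ends e p) (F e c p)
    ...   | no q≢c   = λ c′ → F e q p (conn-mono (λ { (p , ne) → proj₁ (recolour-old q≢c p) , ne }) c′)

    -- For want of an arc from `e` to `g`, the ends of `e` stay joined in the old class of `g`
    -- without `g`. In the class `c`, `recolour-cut` applies; all other classes are unchanged.
    recolour-arc : ∀ {e f q} → col g ≡ just q → Addable col g c → ¬ Addable col e c → ¬ Arc col e g →
                   Arc col e f → Arc (recolour g c col) e f
    recolour-arc {e} {f} {q} col-g add ¬add ¬arc r@(arc i mem joined cut) = arc i mem′ joined′ cut′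
      where
      mem′ : recolour g c col f ≡ just i
      mem′ = trans (recolour-≢ (λ { refl → ¬arc r })) mem
      joined′ : Ends (Class (recolour g c col) i) e
      joined′ with i Fin.≟ q
      ... | no i≢q   = conn-mono (λ p → trans (recolour-≢ (λ { refl → i≢q (Maybe.just-injective (trans (sym p) col-g)) })) p) joined
      ... | yes refl = conn-mono (λ { (p , ne) → trans (recolour-≢ ne) p })
        (decidable-stable (ends? (λ x → class? col i x ×-dec ¬? (x Fin.≟ g)) e) (λ ¬c → ¬arc (arc i col-g joined ¬c)))
      cut′ : ¬ Ends (Class (recolour g c col) i ∖ f) e
      cut′ with i Fin.≟ c
      ... | yes refl = recolour-cut add joined cut
      ... | no i≢c   = λ c′ → cut (conn-mono (λ { (p , ne) → proj₁ (recolour-old i≢c p) , ne }) c′)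

    recolour-path : ∀ {q} → col g ≡ just q → Addable col g c → ∀ {e l} (π : Path col e l) →
                    Before (λ x → ¬ (Addable col x c ⊎ Arc col x g)) π → Path (recolour g c col) e l
    recolour-path col-g add (start eq) _ = start (trans (recolour-≢ λ { refl → contradiction (trans (sym col-g) eq) λ () }) eq)
    recolour-path col-g add (step π r) (¬d , bef) =
      step (recolour-path col-g add π bef) (recolour-arc col-g add (¬d ∘ inj₁) (¬d ∘ inj₂) r)

  free : Colouring → ℕ
  free col = ∑ (allFin m) (λ e → 𝟙 (uncoloured? col e))

  recolour-free : ∀ g c col e → recolour g c col e ≡ nothing → col e ≡ nothing
  recolour-free g c col e p with e Fin.≟ g
  ... | no _ = p

  free-≤ : ∀ g c col → free (recolour g c col) ≤ free col
  free-≤ g c col = ∑-mono (allFin m) (λ e → 𝟙-mono (uncoloured? (recolour g c col) e) (uncoloured? col e) (recolour-free g c col e))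

  free-< : ∀ g c col → col g ≡ nothing → free (recolour g c col) < free col
  free-< g c col eq = ∑-mono-< (λ e → 𝟙-mono (uncoloured? (recolour g c col) e) (uncoloured? col e) (recolour-free g c col e)) (∈-allFin g)
    (𝟙-< (uncoloured? (recolour g c col) g) (uncoloured? col g) coloured eq)
    where
    coloured : recolour g c col g ≢ nothing
    coloured p with g Fin.≟ g
    ... | no ne = ne refl

  Improvement : Colouring → Set
  Improvement col = ∃ λ col′ → Forests col′ × free col′ < free col

  -- Shortcuts are taken first; on a path without shortcuts, moving its last edge g to the class c leaves an
  -- augmenting path that is one step shorter.
  augment : ∀ N {col} → Forests col → ∀ {g l c} → Path col g l → l < N → Addable col g c → Improvement col
  augment (suc N) {col} F {g} {c = c} (start eq) _ add = recolour g c col , recolour-forests F add , free-< g c col eq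
  augment (suc N) {col} F {g} {c = c} (step π r@(arc q mem _ cut)) (s≤s l<N) add
    with scan (λ x → ¬? (ends? (class? col c) x) ⊎-dec arc? col x g) π
  ... | inj₁ (e′ , l′ , l′<l , π′ , inj₁ add′) = augment N F π′ (<-trans l′<l l<N) add′
  ... | inj₁ (e′ , l′ , l′<l , π′ , inj₂ r′)   = augment N F (step π′ r′) (≤-<-trans l′<l l<N) add
  ... | inj₂ bef with augment N (recolour-forests F add) (recolour-path mem add π bef) l<N add′
    where
    q≢c : q ≢ c
    q≢c refl = add (ends g mem)
    -- Once `g` has left class `q`, `cut` says that this class no longer joins the ends of the
    -- preceding edge.
    add′ : Addable (recolour g c col) _ q
    add′ c′ = cut (conn-mono (recolour-old q≢c) c′)
  ...   | col′ , F′ , lt = col′ , F′ , <-≤-trans lt (free-≤ g c col)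

  _∈?_ : ∀ e (X : List (Fin m)) → Dec (e ∈ X)
  e ∈? X = DecMembership._∈?_ Fin._≟_ e X

  Reached : Colouring → Fin m → Set
  Reached col e = ∃ λ l → Path col e l

  -- The set of edges that exchange paths can reach. If none of them is addable to any class, the
  -- components of `X` form the partition that refutes non-spanning classes.
  record Saturated (col : Colouring) : Set where
    field
      X       : List (Fin m)
      reached : ∀ {e} → e ∈ X → Reached col e
      free⊆   : ∀ {e} → col e ≡ nothing → e ∈ X
      closed  : ∀ {e f} → e ∈ X → Arc col e f → f ∈ X

  saturated : ∀ col → Saturated col
  saturated col = go _ (filter (uncoloured? col) (allFin m)) ≤-refl
      (λ e∈ → 0 , start (proj₂ (∈-filter⁻ (uncoloured? col) {xs = allFin m} e∈)))
      (λ {e} p → ∈-filter⁺ (uncoloured? col) (∈-allFin e) p)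
    where
    outside : List (Fin m) → ℕ
    outside X = ∑ (allFin m) (λ e → 𝟙 (¬? (e ∈? X)))
    go : ∀ N X → outside X < N → (∀ {e} → e ∈ X → Reached col e) → (∀ {e} → col e ≡ nothing → e ∈ X) → Saturated col
    go (suc N) X (s≤s lt) reached free⊆
      with Fin.any? (λ e → Fin.any? (λ f → (e ∈? X) ×-dec (¬? (f ∈? X) ×-dec arc? col e f)))
    ... | no none = record { X = X ; reached = reached ; free⊆ = free⊆
                           ; closed = λ {e} {f} e∈ r → decidable-stable (f ∈? X) (λ f∉ → none (e , f , e∈ , f∉ , r)) }
    ... | yes (e , f , e∈ , f∉ , r) = go N (f ∷ X) (<-≤-trans smaller lt)
        (λ { (here refl) → let l , π = reached e∈ in suc l , step π r ; (there x∈) → reached x∈ })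
        (there ∘ free⊆)
      where
      smaller : outside (f ∷ X) < outside X
      smaller = ∑-mono-< (λ x → 𝟙-mono (¬? (x ∈? (f ∷ X))) (¬? (x ∈? X)) (_∘ there)) (∈-allFin f)
                  (𝟙-< (¬? (f ∈? (f ∷ X))) (¬? (f ∈? X)) (λ f∉ → f∉ (here refl)) f∉)

  crossing : (Fin n → Fin n) → ℕ
  crossing f = ∑ (allFin m) (λ e → 𝟙 (¬? (f (a e) Fin.≟ f (b e))))

  -- The condition of Nash-Williams and Tutte, a partition being given by an idempotent choice of
  -- representatives.
  PartitionCondition : Set
  PartitionCondition = ∀ f → (∀ v → f (f v) ≡ f v) → k * (classes f ∸ 1) ≤ crossing f

  -- Saturated packings without an addable edge

  module NoImprovement {col} (F : Forests col) (sat : Saturated col)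
    (blocked : ∀ {e} i → e ∈ Saturated.X sat → Ends (Class col i) e) where
    open Saturated sat

    -- Edges outside `X` are deleted one at a time. As `X` is closed under arcs, the ends of `e` are
    -- joined in class `i` without such a `g`; were every remaining connection to use `g`, the two
    -- connections would close a cycle in a forest.
    prune : ∀ i {e} → e ∈ X → ∀ L → Ends (λ f → Class col i f × ¬ (f ∈ L × f ∉ X)) e
    prune i e∈ [] = conn-mono (λ p → p , λ { (() , _) }) (blocked i e∈)
    prune i {e} e∈ (g ∷ L) with prune i e∈ L | g ∈? X | class? col i g
    ... | c | yes g∈ | _ = conn-mono (λ { (p , np) → p , λ { (here refl , g∉) → g∉ g∈ ; (there f∈ , f∉) → np (f∈ , f∉) } }) c
    ... | c | no g∉ | no ¬p = conn-mono (λ { (p , np) → p , λ { (here refl , _) → ¬p p ; (there f∈ , f∉) → np (f∈ , f∉) } }) c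
    ... | c | no g∉ | yes mem
      with conn-split {Q = λ f → Class col i f × ¬ (f ∈ g ∷ L × f ∉ X)} g split c
      where
      split : ∀ {f} → Class col i f × ¬ (f ∈ L × f ∉ X) → (Class col i f × ¬ (f ∈ g ∷ L × f ∉ X)) ⊎ f ≡ g
      split {f} (p , np) with f Fin.≟ g
      ... | yes eq = inj₂ eq
      ... | no ne  = inj₁ (p , λ { (here eq , _) → ne eq ; (there f∈ , f∉) → np (f∈ , f∉) })
    ... | inj₁ d = d
    ... | inj₂ t = ⊥-elim (F g i mem (through-ends g (λ { (p , np) → p , λ { refl → np (here refl , g∉) } }) t
                     (decidable-stable (ends? (λ x → class? col i x ×-dec ¬? (x Fin.≟ g)) e)
                        (λ ¬c → g∉ (closed e∈ (arc i mem (blocked i e∈) ¬c))))))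

    -- Thus each single class connects every component of `X` from within, and contracting `X` keeps
    -- all classes acyclic.
    spanned : ∀ i {e} → e ∈ X → Ends (λ f → Class col i f × f ∈ X) e
    spanned i e∈ = conn-mono (λ { {f} (p , np) → p , decidable-stable (f ∈? X) (λ f∉ → np (∈-allFin f , f∉)) }) (prune i e∈ (allFin m))

    outer? : ∀ i → Decidable (λ e → Class col i e × e ∉ X)
    outer? i e = class? col i e ×-dec ¬? (e ∈? X)

    outer : Fin k → List (Fin m)
    outer i = filter (outer? i) (allFin m)

    -- Each outer edge merges two components: otherwise, with the edges of `X` replaced by
    -- connections of class `i`, it would lie on a cycle of its class.
    classes-outer : ∀ i {L} → Unique L → (∀ {e} → e ∈ L → Class col i e × e ∉ X) →
                    length L + classes (comp (L ++ X)) ≡ classes (comp X)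
    classes-outer i {[]} _ _ = refl
    classes-outer i {e ∷ L} (e∉ ∷ u) h =
      trans (sym (+-suc (length L) _))
            (trans (cong (length L +_) (classes-∷ e (L ++ X) apart)) (classes-outer i u (h ∘ there)))
      where
      apart : comp (L ++ X) (a e) ≢ comp (L ++ X) (b e)
      apart eq = F e i (proj₁ (h (here refl))) (conn-bind inside (comp⇒conn (L ++ X) eq))
        where
        inside : ∀ {f} → f ∈ L ++ X → Ends (Class col i ∖ e) f
        inside {f} f∈ with ∈-++⁻ L f∈
        ... | inj₁ f∈L = ends f (proj₁ (h (there f∈L)) , λ { refl → All.lookup e∉ f∈L refl })
        ... | inj₂ f∈X = conn-mono (λ { (p , x∈) → p , λ { refl → proj₂ (h (here refl)) x∈ } }) (spanned i f∈X)

    classes-outer′ : ∀ i → length (outer i) + classes (comp (outer i ++ X)) ≡ classes (comp X)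
    classes-outer′ i = classes-outer i (Unique.filter⁺ (outer? i) (Unique.allFin⁺ m))
                         (λ e∈ → proj₂ (∈-filter⁻ (outer? i) {xs = allFin m} e∈))

    outer-≤ : Fin n → ∀ i → length (outer i) ≤ classes (comp X) ∸ 1
    outer-≤ v i = begin
      length (outer i)         ≡⟨ sym (m+n∸n≡m (length (outer i)) 1) ⟩
      length (outer i) + 1 ∸ 1 ≤⟨ ∸-monoˡ-≤ 1 (+-monoʳ-≤ (length (outer i)) (classes-1 _ (comp-idem (outer i ++ X)) v)) ⟩
      length (outer i) + classes (comp (outer i ++ X)) ∸ 1 ≡⟨ cong (_∸ 1) (classes-outer′ i) ⟩
      classes (comp X) ∸ 1     ∎
      where open ≤-Reasoning

    -- By `blocked`, the edges of `outer i` and `X` join only what class `i` joins, so `u` and `v`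
    -- stay apart and at least two components are left.
    outer-< : ∀ i {u v} → ¬ Conn (Class col i) u v → length (outer i) < classes (comp X) ∸ 1
    outer-< i {u} {v} ¬c = begin
      suc (length (outer i))   ≡⟨ sym (m+n∸n≡m (suc (length (outer i))) 1) ⟩
      suc (length (outer i)) + 1 ∸ 1 ≡⟨ cong (_∸ 1) (sym (+-suc (length (outer i)) 1)) ⟩
      length (outer i) + 2 ∸ 1 ≤⟨ ∸-monoˡ-≤ 1 (+-monoʳ-≤ (length (outer i)) (classes-2 _ (comp-idem (outer i ++ X)) {u} {v} apart)) ⟩
      length (outer i) + classes (comp (outer i ++ X)) ∸ 1 ≡⟨ cong (_∸ 1) (classes-outer′ i) ⟩
      classes (comp X) ∸ 1     ∎
      where
      open ≤-Reasoning
      inside : ∀ {f} → f ∈ outer i ++ X → Ends (Class col i) f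
      inside {f} f∈ with ∈-++⁻ (outer i) f∈
      ... | inj₁ f∈o = ends f (proj₁ (proj₂ (∈-filter⁻ (outer? i) {xs = allFin m} f∈o)))
      ... | inj₂ f∈X = blocked i f∈X
      apart : comp (outer i ++ X) u ≢ comp (outer i ++ X) v
      apart eq = ¬c (conn-bind inside (comp⇒conn (outer i ++ X) eq))

    -- An edge between two components of `X` is not in `X`, hence by `free⊆` it is coloured and
    -- outer in its class.
    crossing-≤ : crossing (comp X) ≤ ∑ (allFin k) (λ i → length (outer i))
    crossing-≤ = begin
      crossing (comp X)
        ≤⟨ ∑-mono (allFin m) point ⟩
      ∑ (allFin m) (λ e → ∑ (allFin k) (λ i → 𝟙 (outer? i e)))
        ≡⟨ ∑-swap (allFin m) (allFin k) _ ⟩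
      ∑ (allFin k) (λ i → ∑ (allFin m) (λ e → 𝟙 (outer? i e)))
        ≡⟨ ∑-cong (allFin k) (λ i → sym (length-filter (outer? i) (allFin m))) ⟩
      ∑ (allFin k) (λ i → length (outer i)) ∎
      where
      open ≤-Reasoning
      point : ∀ e → 𝟙 (¬? (comp X (a e) Fin.≟ comp X (b e))) ≤ ∑ (allFin k) (λ i → 𝟙 (outer? i e))
      point e = go (e ∈? X) (col e) refl
        where
        crosses? = ¬? (comp X (a e) Fin.≟ comp X (b e))
        go : Dec (e ∈ X) → ∀ c → col e ≡ c → 𝟙 crosses? ≤ ∑ (allFin k) (λ i → 𝟙 (outer? i e))
        go (yes e∈) _        _  = ≤-trans (𝟙-mono crosses? (no id) (λ ne → ne (comp-ends X e∈))) z≤n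
        go (no e∉)  nothing  eq = ⊥-elim (e∉ (free⊆ eq))
        go (no e∉)  (just i) eq = ≤-trans (𝟙-mono crosses? (outer? i e) (λ _ → eq , e∉))
                                          (term≤∑ (λ i → 𝟙 (outer? i e)) (∈-allFin i))

    contradictory : PartitionCondition → ∀ i {u v} → ¬ ¬ Conn (Class col i) u v
    contradictory pc i {u} ¬c = <-irrefl refl (begin-strict
      k * (classes (comp X) ∸ 1) ≤⟨ pc (comp X) (comp-idem X) ⟩
      crossing (comp X)          ≤⟨ crossing-≤ ⟩
      ∑ (allFin k) (λ i → length (outer i))
        <⟨ ∑-mono-< (outer-≤ u) (∈-allFin i) (outer-< i ¬c) ⟩
      ∑ (allFin k) (λ _ → classes (comp X) ∸ 1) ≡⟨ ∑-const (allFin k) _ ⟩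
      length (allFin k) * (classes (comp X) ∸ 1) ≡⟨ cong (_* (classes (comp X) ∸ 1)) (length-tabulate {n = k} id) ⟩
      k * (classes (comp X) ∸ 1) ∎)
      where open ≤-Reasoning

  Spanning : Colouring → Set
  Spanning col = ∀ i u v → Conn (Class col i) u v

  improve : PartitionCondition → ∀ col → Forests col → Improvement col ⊎ Spanning col
  improve pc col F with saturated col
  ... | sat with Fin.any? (λ e → Fin.any? (λ i → (e ∈? Saturated.X sat) ×-dec ¬? (ends? (class? col i) e)))
  ...   | yes (e , i , e∈ , add) = inj₁ (augment _ F (proj₂ (Saturated.reached sat e∈)) ≤-refl add)
  ...   | no none = inj₂ λ i u v → decidable-stable (conn? (class? col i) u v)
            (NoImprovement.contradictory F sat
              (λ {e} i e∈ → decidable-stable (ends? (class? col i) e) (λ add → none (e , i , e∈ , add))) pc i)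

  -- The theorem of Nash-Williams and Tutte: starting with no edge coloured, every improvement
  -- lowers `free`. Only connectivity is recorded; the trees are selected later by distance from a
  -- root.
  spanning-trees : PartitionCondition → ∃ Spanning
  spanning-trees pc = go _ (λ _ → nothing) (λ _ _ ()) ≤-refl
    where
    go : ∀ N col → Forests col → free col < N → ∃ Spanning
    go (suc N) col F (s≤s lt) with improve pc col F
    ... | inj₂ sp = col , sp
    ... | inj₁ (col′ , F′ , lt′) = go N col′ F′ (<-≤-trans lt′ lt)

-- Iterates and walks

iter : (A → A) → ℕ → A → A
iter f zero    x = x
iter f (suc N) x = iter f N (f x)

iter-suc : ∀ (f : A → A) N x → iter f (suc N) x ≡ f (iter f N x)
iter-suc f zero    x = refl
iter-suc f (suc N) x = iter-suc f N (f x)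

start∈vertices : ∀ {R : A → A → Set} {u v} (p : Walk R u v) → u ∈ vertices R p
start∈vertices nil        = here refl
start∈vertices (cons _ _) = here refl

end∈vertices : ∀ {R : A → A → Set} {u v} (p : Walk R u v) → v ∈ vertices R p
end∈vertices nil        = here refl
end∈vertices (cons _ p) = there (end∈vertices p)

edges⇒related : ∀ {R : A → A → Set} {u v c d} (p : Walk R u v) → (c , d) ∈ edges R p → R c d
edges⇒related (cons r p) (here refl) = r
edges⇒related (cons r p) (there cd∈) = edges⇒related p cd∈

-- Trees from parent pointers

-- In H ─ S the proof of v ∉ S is part of a vertex, so several vertices may lie over the same v, and being the root is
-- not decidable. Hence the root gets a pointer too: the pointers run into the 2-cycle between ρ and par ρ, and all
-- other vertices over the same v as ρ become leaves at par ρ.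
module PointerTree (H : Graph) (par : V H → V H) (par-adj : ∀ x → Adj H x (par x))
  (ρ : V H) (par²ρ : par (par ρ) ≡ ρ) (reach : ∀ x → ∃ λ N → iter par N x ≡ ρ) where

  Link : V H → V H → Set
  Link x y = y ≡ par x ⊎ x ≡ par y

  iter-par² : ∀ N {x} → par (par x) ≡ x → par (par (iter par N x)) ≡ iter par N x
  iter-par² zero    eq = eq
  iter-par² (suc N) eq = iter-par² N (cong par eq)

  iter-par²-cases : ∀ N {x} → par (par x) ≡ x → iter par N x ≡ x ⊎ iter par N x ≡ par x
  iter-par²-cases zero    eq = inj₁ refl
  iter-par²-cases (suc N) eq with iter-par²-cases N (cong par eq)
  ... | inj₁ e = inj₂ e
  ... | inj₂ e = inj₁ (trans e eq)

  periodic⇒return : ∀ {x j} → iter par (suc j) x ≡ x → ∀ N → ∃ λ M → iter par M (iter par N x) ≡ x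
  periodic⇒return per zero = 0 , refl
  periodic⇒return {x} {j} per (suc N) with periodic⇒return {x} {j} per N
  ... | suc M , eq = M , trans (cong (iter par M) (iter-suc par N x)) eq
  ... | zero  , eq = j , trans (cong (iter par j) (trans (iter-suc par N x) (cong par eq))) per

  -- The orbit of a periodic `x` meets `ρ` and returns to `x`, so `x` lies on the 2-cycle of `ρ`.
  periodic⇒par² : ∀ {x j} → iter par (suc j) x ≡ x → par (par x) ≡ x
  periodic⇒par² {x} {j} per with reach x
  ... | N , eq with periodic⇒return {x} {j} per N
  ... | M , eq′ = subst (λ z → par (par z) ≡ z) (trans (cong (iter par M) (sym eq)) eq′) (iter-par² M par²ρ)

  -- A path that has come from `x` to `y` against the pointer of `y` cannot follow that pointer back
  -- to `x`, so all its further steps run against the pointers.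
  descent : ∀ {x y w} (q : Walk Link y w) → x ≡ par y → x ∉ vertices Link q → IsPath Link q →
            (∃ λ k → iter par k w ≡ y) × (w ≡ y ⊎ par w ∈ vertices Link q)
  descent nil _ _ _ = (0 , refl) , inj₁ refl
  descent (cons (inj₁ refl) q) refl x∉ u = ⊥-elim (x∉ (there (start∈vertices q)))
  descent {w = w} (cons (inj₂ y≡) q) x≡ x∉ (y∉ ∷ u) with descent q y≡ (λ y∈ → All.lookup y∉ y∈ refl) u
  ... | (k , eq) , alt = (suc k , trans (iter-suc par k w) (trans (cong par eq) (sym y≡)))
                       , inj₂ ([ (λ w≡z → here (trans (cong par w≡z) (sym y≡))) , there ] alt)

  -- After a single step against the pointers, `descent` would put `par w`, which is `u`, on the
  -- path, or make `u` the vertex before that step.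
  ascent : ∀ {u y w} (q : Walk Link y w) → u ≡ par w → u ∉ vertices Link q → IsPath Link q →
           ∃ λ k → iter par k y ≡ w
  ascent nil _ _ _ = 0 , refl
  ascent (cons (inj₁ refl) q) u≡ u∉ (_ ∷ uq) with ascent q u≡ (u∉ ∘ there) uq
  ... | k , eq = suc k , eq
  ascent (cons (inj₂ y≡) q) u≡ u∉ (y∉ ∷ uq) with descent q y≡ (λ y∈ → All.lookup y∉ y∈ refl) uq
  ... | _ , inj₁ w≡z = ⊥-elim (u∉ (here (trans u≡ (trans (cong par w≡z) (sym y≡)))))
  ... | _ , inj₂ pw∈ = ⊥-elim (u∉ (there (subst (_∈ _) (sym u≡) pw∈)))

  -- The first and the closing step decide. If both run the same way round, pointers circulate and
  -- the period is at most two. Otherwise `w` and `v₁` coincide, or `u` occurs a second time.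
  acyclic : Acyclic Link
  acyclic nil _ (s≤s ()) _
  acyclic (cons _ nil) _ (s≤s (s≤s ())) _
  acyclic {u} {w} (cons {w = v₁} r q@(cons _ q′)) (u∉ ∷ uq@(v₁∉ ∷ _)) _ closing = go r closing
    where
    u∉q : u ∉ vertices Link q
    u∉q u∈ = All.lookup u∉ u∈ refl
    w≢v₁ : w ≢ v₁
    w≢v₁ w≡ = All.lookup v₁∉ (end∈vertices q′) (sym w≡)
    go : Link u v₁ → Link w u → ⊥
    go (inj₁ v₁≡) (inj₂ w≡) = w≢v₁ (trans w≡ (sym v₁≡))
    go (inj₁ refl) (inj₁ u≡) with ascent q u≡ u∉q uq
    ... | k , eq = [ w≢v₁ , (λ w≡ → u∉q (subst (_∈ vertices Link q) (trans w≡ par²u) (end∈vertices q))) ]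
                     (Sum.map (trans (sym eq)) (trans (sym eq)) (iter-par²-cases k (cong par par²u)))
      where
      par²u : par (par u) ≡ u
      par²u = periodic⇒par² {u} {suc k} (trans (iter-suc par (suc k) u) (trans (cong par eq) (sym u≡)))
    go (inj₂ u≡) (inj₁ u≡′) with descent q u≡ u∉q uq
    ... | _ , inj₁ w≡v₁ = w≢v₁ w≡v₁
    ... | _ , inj₂ pw∈  = u∉q (subst (_∈ vertices Link q) (sym u≡′) pw∈)
    go (inj₂ refl) (inj₂ refl) with descent q refl u∉q uq
    ... | (k , eq) , _ = w≢v₁ (periodic⇒par² {v₁} {suc k} eq)

  to-root : ∀ N {x} → iter par N x ≡ ρ → Star Link x ρ
  to-root zero    refl = ε
  to-root (suc N) eq   = inj₁ refl ◅ to-root N eq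

  tree : SpanningTree H
  tree = record
    { TAdj     = Link
    ; TAdj-sub = λ { {u} (inj₁ refl) → par-adj u ; {v = v} (inj₂ refl) → Adj-sym H (par-adj v) }
    ; TAdj-sym = swap
    ; T-conn   = ρ , λ u v → let N , eq = reach u ; M , eq′ = reach v in
                   to-root N eq ◅◅ Star.reverse swap (to-root M eq′)
    ; T-acyc   = acyclic
    }

  -- If neither neighbour on the path pointed to an inner vertex, both would be its own pointer
  -- target, and the path would repeat it.
  inner-vertex : ∀ {u v x} (p : Walk Link u v) → IsPath Link p → x ∈ vertices Link p →
                 (x ≡ u ⊎ x ≡ v) ⊎ ∃ λ y → x ≡ par y
  inner-vertex nil        _ (here x≡) = inj₁ (inj₁ x≡)
  inner-vertex (cons _ _) _ (here x≡) = inj₁ (inj₁ x≡)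
  inner-vertex (cons r q) (u∉ ∷ uq) (there x∈) with inner-vertex q uq x∈
  ... | inj₂ im          = inj₂ im
  ... | inj₁ (inj₂ x≡v)  = inj₁ (inj₂ x≡v)
  ... | inj₁ (inj₁ refl) = second r q u∉
    where
    second : ∀ {u w v} → Link u w → (q : Walk Link w v) → All.All (u ≢_) (vertices Link q) →
             (w ≡ u ⊎ w ≡ v) ⊎ ∃ λ y → w ≡ par y
    second _                nil                   _  = inj₁ (inj₂ refl)
    second (inj₁ w≡)        (cons _ _)            _  = inj₂ (_ , w≡)
    second (inj₂ _)         (cons (inj₂ w≡) _)    _  = inj₂ (_ , w≡)
    second (inj₂ refl)      (cons (inj₁ refl) q)  u∉ = ⊥-elim (All.lookup u∉ (there (start∈vertices q)) refl)

module PointerTrees (H : Graph) {k : ℕ} (par : Fin k → V H → V H) (par-adj : ∀ i x → Adj H x (par i x))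
  (ρ : Fin k → V H) (par²ρ : ∀ i → par i (par i (ρ i)) ≡ ρ i) (reach : ∀ i x → ∃ λ N → iter (par i) N x ≡ ρ i)
  (disjoint : ∀ {i j} → i ≢ j → ∀ x y → par i x ≢ par j y)
  (no-conflict : ∀ {i j} → i ≢ j → ∀ x → par j (par i x) ≢ x) where

  private module T i = PointerTree H (par i) (par-adj i) (ρ i) (par²ρ i) (reach i)

  -- Two pointers along the same edge either have the same target, against `disjoint`, or are
  -- opposite, against `no-conflict`.
  link-disjoint : ∀ {i j} → i ≢ j → ∀ {x y} → T.Link i x y → ¬ T.Link j x y
  link-disjoint i≢j (inj₁ p)    (inj₁ q)    = disjoint i≢j _ _ (trans (sym p) q)
  link-disjoint i≢j (inj₁ refl) (inj₂ q)    = no-conflict i≢j _ (sym q)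
  link-disjoint i≢j (inj₂ refl) (inj₁ q)    = no-conflict i≢j _ (sym q)
  link-disjoint i≢j (inj₂ p)    (inj₂ q)    = disjoint i≢j _ _ (trans (sym p) q)

  cists : HasCISTs H k
  cists = T.tree , λ i j i≢j u v u≢v p q path-p path-q →
      (λ c d cd∈ → (λ cd∈′ → link-disjoint i≢j (edges⇒related p cd∈) (edges⇒related q cd∈′))
                 , (λ dc∈′ → link-disjoint i≢j (edges⇒related p cd∈) (swap (edges⇒related q dc∈′))))
    , λ x x∈p x∈q → common i≢j (T.inner-vertex i p path-p x∈p) (T.inner-vertex j q path-q x∈q)
    where
    common : ∀ {i j} → i ≢ j → ∀ {u v x} → (x ≡ u ⊎ x ≡ v) ⊎ (∃ λ y → x ≡ par i y) →
             (x ≡ u ⊎ x ≡ v) ⊎ (∃ λ y → x ≡ par j y) → x ≡ u ⊎ x ≡ v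
    common i≢j (inj₁ end)     _              = end
    common i≢j (inj₂ _)       (inj₁ end)     = end
    common i≢j (inj₂ (y , p)) (inj₂ (z , q)) = ⊥-elim (disjoint i≢j y z (trans (sym p) q))

-- Edges of G

module Edges {n : ℕ} (G : FinGraph n) where

  edge-≡ : ∀ {e f : Edge G} → end₁ e ≡ end₁ f → end₂ e ≡ end₂ f → e ≡ f
  edge-≡ {edge _ _ o p} {edge _ _ o′ p′} refl refl = cong₂ (edge _ _) (Fin.<-irrelevant o o′) (WithK.≡-irrelevant p p′)

  _≟ₑ_ : DecidableEquality (Edge G)
  e ≟ₑ f with end₁ e Fin.≟ end₁ f | end₂ e Fin.≟ end₂ f
  ... | yes p | yes q = yes (edge-≡ p q)
  ... | no ¬p | _     = no λ { refl → ¬p refl }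
  ... | yes _ | no ¬q = no λ { refl → ¬q refl }

  _∈?_ : ∀ e (F : List (Edge G)) → Dec (e ∈ F)
  e ∈? F = DecMembership._∈?_ _≟ₑ_ e F

  Between : Edge G → Fin n → Fin n → Set
  Between e u v = (end₁ e ≡ u × end₂ e ≡ v) ⊎ (end₁ e ≡ v × end₂ e ≡ u)

  Incident : Edge G → Fin n → Set
  Incident e v = end₁ e ≡ v ⊎ end₂ e ≡ v

  incident? : ∀ e v → Dec (Incident e v)
  incident? e v = (end₁ e Fin.≟ v) ⊎-dec (end₂ e Fin.≟ v)

  ends-≢ : ∀ (e : Edge G) → end₁ e ≢ end₂ e
  ends-≢ e eq = Fin.<-irrefl eq (ord e)

  between-≢ : ∀ e {u v} → Between e u v → u ≢ v
  between-≢ e (inj₁ (refl , refl)) eq = ends-≢ e eq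
  between-≢ e (inj₂ (refl , refl)) eq = ends-≢ e (sym eq)

  between-unique : ∀ {e f u v} → Between e u v → Between f u v → e ≡ f
  between-unique (inj₁ (p , q)) (inj₁ (r , s)) = edge-≡ (trans p (sym r)) (trans q (sym s))
  between-unique (inj₂ (p , q)) (inj₂ (r , s)) = edge-≡ (trans p (sym r)) (trans q (sym s))
  between-unique {e} {f} (inj₁ (refl , refl)) (inj₂ (r , s)) = ⊥-elim (Fin.<-asym (ord e) (subst₂ Fin._<_ r s (ord f)))
  between-unique {e} {f} (inj₂ (refl , refl)) (inj₁ (r , s)) = ⊥-elim (Fin.<-asym (ord e) (subst₂ Fin._<_ r s (ord f)))

  incident⇒between : ∀ e {u v} → u ≢ v → Incident e u → Incident e v → Between e u v
  incident⇒between e u≢v (inj₁ p) (inj₁ q) = ⊥-elim (u≢v (trans (sym p) q))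
  incident⇒between e u≢v (inj₁ p) (inj₂ q) = inj₁ (p , q)
  incident⇒between e u≢v (inj₂ p) (inj₁ q) = inj₂ (q , p)
  incident⇒between e u≢v (inj₂ p) (inj₂ q) = ⊥-elim (u≢v (trans (sym p) q))

  between⇒incidentˡ : ∀ e {u v} → Between e u v → Incident e u
  between⇒incidentˡ e (inj₁ (p , _)) = inj₁ p
  between⇒incidentˡ e (inj₂ (_ , p)) = inj₂ p

  between⇒incidentʳ : ∀ e {u v} → Between e u v → Incident e v
  between⇒incidentʳ e (inj₁ (_ , p)) = inj₂ p
  between⇒incidentʳ e (inj₂ (p , _)) = inj₁ p

  between⇒adj : ∀ e {u v} → Between e u v → adj G u v ≡ true
  between⇒adj e (inj₁ (refl , refl)) = isE e
  between⇒adj e (inj₂ (refl , refl)) = trans (adj-sym G _ _) (isE e)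

  adj⇒between : ∀ {u v} → adj G u v ≡ true → ∃ λ e → Between e u v
  adj⇒between {u} {v} p with Fin.<-cmp u v
  ... | tri< u<v _ _  = edge u v u<v p , inj₁ (refl , refl)
  ... | tri≈ _ refl _ = ⊥-elim (adj-irr′ G p)
  ... | tri> _ _ v<u  = edge v u v<u (trans (adj-sym G v u) p) , inj₂ (refl , refl)

  incident⇒shareEnd : ∀ (e f : Edge G) {v} → Incident e v → Incident f v → ShareEnd e f
  incident⇒shareEnd e f (inj₁ p) (inj₁ q) = inj₁ (inj₁ (trans p (sym q)))
  incident⇒shareEnd e f (inj₁ p) (inj₂ q) = inj₁ (inj₂ (trans p (sym q)))
  incident⇒shareEnd e f (inj₂ p) (inj₁ q) = inj₂ (inj₁ (trans p (sym q)))
  incident⇒shareEnd e f (inj₂ p) (inj₂ q) = inj₂ (inj₂ (trans p (sym q)))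

  shareEnd⇒incident : ∀ (e f : Edge G) → ShareEnd e f → ∃ λ v → Incident e v × Incident f v
  shareEnd⇒incident e f (inj₁ (inj₁ p)) = _ , inj₁ refl , inj₁ (sym p)
  shareEnd⇒incident e f (inj₁ (inj₂ p)) = _ , inj₁ refl , inj₂ (sym p)
  shareEnd⇒incident e f (inj₂ (inj₁ p)) = _ , inj₂ refl , inj₁ (sym p)
  shareEnd⇒incident e f (inj₂ (inj₂ p)) = _ , inj₂ refl , inj₂ (sym p)

  edgesBetween : Fin n → Fin n → List (Edge G)
  edgesBetween u v with adj G u v Bool.≟ true
  ... | yes p = proj₁ (adj⇒between p) ∷ []
  ... | no _  = []

  allEdges : List (Edge G)
  allEdges = deduplicate _≟ₑ_ (concatMap (λ u → concatMap (edgesBetween u) (allFin n)) (allFin n))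

  allEdges-unique : Unique allEdges
  allEdges-unique = deduplicate-! _≟ₑ_ _

  ∈-allEdges : ∀ e → e ∈ allEdges
  ∈-allEdges e = ∈-deduplicate⁺ _≟ₑ_
    (∈-concatMap⁺ (λ u → concatMap (edgesBetween u) (allFin n)) (Any.map (λ { refl →
      ∈-concatMap⁺ (edgesBetween (end₁ e)) (Any.map (λ { refl → found }) (∈-allFin (end₂ e))) }) (∈-allFin (end₁ e))))
    where
    found : e ∈ edgesBetween (end₁ e) (end₂ e)
    found with adj G (end₁ e) (end₂ e) Bool.≟ true
    ... | yes p = here (between-unique (inj₁ (refl , refl)) (proj₂ (adj⇒between p)))
    ... | no ¬p = ⊥-elim (¬p (isE e))

  any-edge? : ∀ {P : Edge G → Set} → Decidable P → Dec (∃ P)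
  any-edge? P? with Any.any? P? allEdges
  ... | yes some = yes (Any.satisfied some)
  ... | no none  = no λ { (e , p) → none (Any.map (λ { refl → p }) (∈-allEdges e)) }

-- Edge cuts

module EdgeCuts {n : ℕ} (G : FinGraph n) where
  open Edges G

  edgeIn⇒∈ : ∀ {F e u v} → Between e u v → EdgeIn F u v → e ∈ F
  edgeIn⇒∈ b (here b′)  = here (between-unique b b′)
  edgeIn⇒∈ b (there x∈) = there (edgeIn⇒∈ b x∈)

  ∈⇒edgeIn : ∀ {F e u v} → Between e u v → e ∈ F → EdgeIn F u v
  ∈⇒edgeIn b = Any.map λ { refl → b }

  along-edge : ∀ {F} e → e ∉ F → ∀ {u v} → Incident e u → Incident e v → Star (Adj (removeEdges G F)) u v
  along-edge e e∉ {u} {v} p q with u Fin.≟ v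
  ... | yes refl = ε
  ... | no u≢v   = let b = incident⇒between e u≢v p q in (between⇒adj e b , λ x → e∉ (edgeIn⇒∈ b x)) ◅ ε

  along-walk : ∀ {F} {x y : V (LineGraph G ─ F)} → Star (Adj (LineGraph G ─ F)) x y →
               ∀ {u v} → Incident (proj₁ x) u → Incident (proj₁ y) v → Star (Adj (removeEdges G F)) u v
  along-walk {x = e , e∉} ε p q = along-edge e e∉ p q
  along-walk {x = e , e∉} (_◅_ {j = f , _} (_ , share) w) p q with shareEnd⇒incident e f share
  ... | z , e-z , f-z = along-edge e e∉ p e-z ◅◅ along-walk w f-z q

  -- If `F` isolates no vertex, every vertex has an edge outside `F`. Were `L(G) - F` connected, its
  -- walks between such edges would connect `G - F`.
  cut-dichotomy : ∀ {κ} → IsConnectivity (LineGraph G) κ → ∀ F → IsEdgeCut G F → κ ≤ length F ⊎ Isolates G F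
  cut-dichotomy (_ , κ-min) F (F-unique , ¬conn)
    with Fin.any? (λ v → ¬? (any-edge? (λ e → incident? e v ×-dec ¬? (e ∈? F))))
  ... | yes (v , isolated) = inj₂ (v , λ e inc → decidable-stable (e ∈? F) (λ e∉ → isolated (e , inc , e∉)))
  ... | no none = inj₁ (κ-min F F-unique (inj₁ λ { ((e , _) , conn) →
          ¬conn (end₁ e , λ u v → let eᵤ , p , eᵤ∉ = escape u ; eᵥ , q , eᵥ∉ = escape v in
                                  along-walk (conn (eᵤ , eᵤ∉) (eᵥ , eᵥ∉)) p q) }))
    where
    escape : ∀ v → ∃ λ e → Incident e v × e ∉ F
    escape v = decidable-stable (any-edge? (λ e → incident? e v ×-dec ¬? (e ∈? F))) (λ ¬esc → none (v , ¬esc))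

  isolates⇒degree : ∀ F {v} → (∀ e → Incident e v → e ∈ F) → degree G v ≤ length F
  isolates⇒degree F {v} iso = length-≤ (λ w e → Between e v w) (λ {w} {w′} {e} → inj {w} {w′} {e}) (Unique.filter⁺ adj? (Unique.allFin⁺ n))
    λ {w} w∈ → let e , b = adj⇒between (proj₂ (∈-filter⁻ adj? {xs = allFin n} w∈)) in e , iso e (between⇒incidentˡ e b) , b
    where
    adj? = λ w → adj G v w Bool.≟ true
    inj : ∀ {w w′ e} → Between e v w → Between e v w′ → w ≡ w′
    inj (inj₁ (_ , p)) (inj₁ (_ , q)) = trans (sym p) q
    inj (inj₂ (p , _)) (inj₂ (q , _)) = trans (sym p) q
    inj {e = e} (inj₁ (p , _)) (inj₂ (_ , q)) = ⊥-elim (ends-≢ e (trans p (sym q)))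
    inj {e = e} (inj₂ (_ , p)) (inj₁ (q , _)) = ⊥-elim (ends-≢ e (trans q (sym p)))

  cut-≥-min : ∀ {δ κ} → IsMinDegree G δ → IsConnectivity (LineGraph G) κ →
              ∀ F → IsEdgeCut G F → δ ⊓ κ ≤ length F
  cut-≥-min {δ} {κ} (_ , δ-min) conn F cut with cut-dichotomy conn F cut
  ... | inj₁ κ≤        = ≤-trans (m⊓n≤n δ κ) κ≤
  ... | inj₂ (v , iso) = ≤-trans (m⊓n≤m δ κ) (≤-trans (δ-min v) (isolates⇒degree F iso))

  -- A cut smaller than κ(L(G)) would force every minimum cut to isolate a vertex.
  cut-≥-κ : ∀ {κ} → Connected (toGraph G) → IsConnectivity (LineGraph G) κ → ¬ SuperEdgeConnected G →
            ∀ F → IsEdgeCut G F → κ ≤ length F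
  cut-≥-κ {κ} G-conn conn ¬super F cut with κ ≤? length F
  ... | yes κ≤ = κ≤
  ... | no κ≰  = ⊥-elim (¬super (G-conn , λ F′ min → isolates F′ min (cut-dichotomy conn F′ (proj₁ min))))
    where
    isolates : ∀ F′ → IsMinEdgeCut G F′ → κ ≤ length F′ ⊎ Isolates G F′ → Isolates G F′
    isolates F′ min (inj₁ κ≤)  = ⊥-elim (κ≰ (≤-trans κ≤ (proj₂ min F cut)))
    isolates F′ min (inj₂ iso) = iso

  -- Here `k` and `h` are the halves of `d`, there are `2 + q` classes, and `x` crossing edges
  -- survive the deletion of `S`. The slack comes from replacing `k + k` by `k + h` in `q` of the
  -- terms.
  partition-arith : ∀ k h q x → (2 + q) * (k + h) ≤ 2 * (x + h) → k ≤ h → k * (1 + q) ≤ x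
  partition-arith k h q x le k≤h = *-cancelˡ-≤ 2 (+-cancelʳ-≤ (2 * h) _ _ (begin
    2 * (k * (1 + q)) + 2 * h       ≡⟨ expand k h q ⟩
    q * (k + k) + (2 * k + 2 * h)   ≤⟨ +-monoˡ-≤ _ (*-monoʳ-≤ q (+-monoʳ-≤ k k≤h)) ⟩
    q * (k + h) + (2 * k + 2 * h)   ≡⟨ collect k h q ⟩
    (2 + q) * (k + h)               ≤⟨ le ⟩
    2 * (x + h)                     ≡⟨ *-distribˡ-+ 2 x h ⟩
    2 * x + 2 * h                   ∎))
    where
    open ≤-Reasoning
    expand : ∀ k h q → 2 * (k * (1 + q)) + 2 * h ≡ q * (k + k) + (2 * k + 2 * h)
    expand = solve-∀
    collect : ∀ k h q → q * (k + h) + (2 * k + 2 * h) ≡ (2 + q) * (k + h)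
    collect = solve-∀

  -- Edges crossing a partition

  module _ (d : ℕ) (cut-≥ : ∀ F → IsEdgeCut G F → d ≤ length F) where

    module _ (f : Fin n → Fin n) where

      crosses? : ∀ (e : Edge G) → Dec (f (end₁ e) ≢ f (end₂ e))
      crosses? e = ¬? (f (end₁ e) Fin.≟ f (end₂ e))

      boundary? : ∀ c (e : Edge G) → Dec ((f (end₁ e) ≢ f (end₂ e)) × (f (end₁ e) ≡ c ⊎ f (end₂ e) ≡ c))
      boundary? c e = crosses? e ×-dec ((f (end₁ e) Fin.≟ c) ⊎-dec (f (end₂ e) Fin.≟ c))

      boundary : Fin n → List (Edge G)
      boundary c = filter (boundary? c) allEdges

      -- A walk that avoids the boundary of the class of `c` never leaves this class.
      boundary-isCut : ∀ {c v} → f c ≡ c → f v ≢ c → IsEdgeCut G (boundary c)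
      boundary-isCut {c} {v} fc fv = Unique.filter⁺ (boundary? c) allEdges-unique
                                   , λ { (_ , conn) → fv (stays fc (conn c v)) }
        where
        stays-step : ∀ {u w} → f u ≡ c → Adj (removeEdges G (boundary c)) u w → f w ≡ c
        stays-step {u} {w} fu (uw , ∉b) with f w Fin.≟ c | adj⇒between uw
        ... | yes fw | _ = fw
        ... | no fw  | e , btw = ⊥-elim (∉b (∈⇒edgeIn btw (∈-filter⁺ (boundary? c) (∈-allEdges e) (on-boundary btw))))
          where
          on-boundary : Between e u w → (f (end₁ e) ≢ f (end₂ e)) × (f (end₁ e) ≡ c ⊎ f (end₂ e) ≡ c)
          on-boundary (inj₁ (refl , refl)) = (λ eq → fw (trans (sym eq) fu)) , inj₁ fu
          on-boundary (inj₂ (refl , refl)) = (λ eq → fw (trans eq fu)) , inj₂ fu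
        stays : ∀ {u w} → f u ≡ c → Star (Adj (removeEdges G (boundary c))) u w → f w ≡ c
        stays fu ε       = fu
        stays fu (s ◅ w) = stays (stays-step fu s) w

      other-class : 2 ≤ classes f → ∀ c → ∃ λ v → f v ≢ c
      other-class 2≤ c with Fin.any? (λ v → ¬? (f v Fin.≟ c))
      ... | yes other = other
      ... | no none = ⊥-elim (<-irrefl refl (begin-strict
            1     <⟨ 2≤ ⟩
            classes f ≤⟨ ∑-mono (allFin n) (λ v → 𝟙-mono (f v Fin.≟ v) (v Fin.≟ c)
                       (λ fv → trans (sym fv) (decidable-stable (f v Fin.≟ c) (λ ne → none (v , ne))))) ⟩
            ∑ (allFin n) (λ v → 𝟙 (v Fin.≟ c)) ≡⟨ ∑-𝟙-≡ Fin._≟_ (Unique.allFin⁺ n) (∈-allFin c) ⟩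
            1     ∎))
        where open ≤-Reasoning

      -- The boundary of each class is an edge cut, so it has at least `d` edges, and a crossing
      -- edge lies on the boundaries of at most two classes.
      double-count : 2 ≤ classes f → classes f * d ≤ 2 * ∑ allEdges (𝟙 ∘ crosses?)
      double-count 2≤ = begin
        classes f * d
          ≡⟨ *-comm (classes f) d ⟩
        d * classes f
          ≡⟨ sym (∑-*ˡ (allFin n) d _) ⟩
        ∑ (allFin n) (λ c → d * 𝟙 (f c Fin.≟ c))
          ≤⟨ ∑-mono (allFin n) per-class ⟩
        ∑ (allFin n) (λ c → ∑ allEdges (λ e → 𝟙 (boundary? c e)))
          ≡⟨ ∑-swap (allFin n) allEdges _ ⟩
        ∑ allEdges (λ e → ∑ (allFin n) (λ c → 𝟙 (boundary? c e)))
          ≤⟨ ∑-mono allEdges per-edge ⟩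
        ∑ allEdges (λ e → 2 * 𝟙 (crosses? e))
          ≡⟨ ∑-*ˡ allEdges 2 _ ⟩
        2 * ∑ allEdges (𝟙 ∘ crosses?) ∎
        where
        open ≤-Reasoning
        per-class : ∀ c → d * 𝟙 (f c Fin.≟ c) ≤ ∑ allEdges (λ e → 𝟙 (boundary? c e))
        per-class c with f c Fin.≟ c
        ... | no _   = ≤-trans (≤-reflexive (*-zeroʳ d)) z≤n
        ... | yes fc = begin
          d * 1               ≡⟨ *-identityʳ d ⟩
          d                   ≤⟨ cut-≥ (boundary c) (boundary-isCut fc (proj₂ (other-class 2≤ c))) ⟩
          length (boundary c) ≡⟨ length-filter (boundary? c) allEdges ⟩
          ∑ allEdges (λ e → 𝟙 (boundary? c e)) ∎
        one : ∀ x → ∑ (allFin n) (λ c → 𝟙 (c Fin.≟ x)) ≡ 1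
        one x = ∑-𝟙-≡ Fin._≟_ (Unique.allFin⁺ n) (∈-allFin x)
        per-edge : ∀ e → ∑ (allFin n) (λ c → 𝟙 (boundary? c e)) ≤ 2 * 𝟙 (crosses? e)
        per-edge e = begin
          ∑ (allFin n) (λ c → 𝟙 (boundary? c e))
            ≤⟨ ∑-mono (allFin n) (λ c → point c (crosses? e)) ⟩
          ∑ (allFin n) (λ c → 𝟙 (crosses? e) * (𝟙 (c Fin.≟ f (end₁ e)) + 𝟙 (c Fin.≟ f (end₂ e))))
            ≡⟨ ∑-*ˡ (allFin n) (𝟙 (crosses? e)) _ ⟩
          𝟙 (crosses? e) * ∑ (allFin n) (λ c → 𝟙 (c Fin.≟ f (end₁ e)) + 𝟙 (c Fin.≟ f (end₂ e)))
            ≡⟨ cong (𝟙 (crosses? e) *_) (trans (∑-+ (allFin n) _ _) (cong₂ _+_ (one _) (one _))) ⟩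
          𝟙 (crosses? e) * 2
            ≡⟨ *-comm (𝟙 (crosses? e)) 2 ⟩
          2 * 𝟙 (crosses? e) ∎
          where
          point : ∀ c (cr? : Dec (f (end₁ e) ≢ f (end₂ e))) →
                  𝟙 (boundary? c e) ≤ 𝟙 cr? * (𝟙 (c Fin.≟ f (end₁ e)) + 𝟙 (c Fin.≟ f (end₂ e)))
          point c (no ¬cr) = 𝟙-mono (boundary? c e) (no id) (¬cr ∘ proj₁)
          point c (yes _)  = ≤-trans (𝟙-⊎ (boundary? c e) (c Fin.≟ f (end₁ e)) (c Fin.≟ f (end₂ e))
                                       (λ { (_ , inj₁ p) → inj₁ (sym p) ; (_ , inj₂ p) → inj₂ (sym p) }))
                                     (≤-reflexive (sym (+-identityʳ _)))

    module _ (S : List (Edge G)) (|S|≤ : length S ≤ ⌈ d /2⌉) where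

      remaining : List (Edge G)
      remaining = filter (λ e → ¬? (e ∈? S)) allEdges

      survivors : ∀ {P : Edge G → Set} (P? : Decidable P) → ∑ allEdges (𝟙 ∘ P?) ≤ ∑ remaining (𝟙 ∘ P?) + length S
      survivors P? = begin
        ∑ allEdges (𝟙 ∘ P?)
          ≤⟨ ∑-mono allEdges point ⟩
        ∑ allEdges (λ e → 𝟙 (¬? (e ∈? S)) * 𝟙 (P? e) + 𝟙 (e ∈? S))
          ≡⟨ ∑-+ allEdges _ _ ⟩
        ∑ allEdges (λ e → 𝟙 (¬? (e ∈? S)) * 𝟙 (P? e)) + ∑ allEdges (λ e → 𝟙 (e ∈? S))
          ≡⟨ cong₂ _+_ (sym (∑-filter (λ e → ¬? (e ∈? S)) allEdges (𝟙 ∘ P?))) (sym (length-filter (_∈? S) allEdges)) ⟩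
        ∑ remaining (𝟙 ∘ P?) + length (filter (_∈? S) allEdges)
          ≤⟨ +-monoʳ-≤ _ (length-≤ _≡_ (λ p q → trans p (sym q)) (Unique.filter⁺ (_∈? S) allEdges-unique)
                           (λ x∈ → _ , proj₂ (∈-filter⁻ (_∈? S) {xs = allEdges} x∈) , refl)) ⟩
        ∑ remaining (𝟙 ∘ P?) + length S ∎
        where
        open ≤-Reasoning
        point : ∀ e → 𝟙 (P? e) ≤ 𝟙 (¬? (e ∈? S)) * 𝟙 (P? e) + 𝟙 (e ∈? S)
        point e with e ∈? S
        ... | yes _ = 𝟙-mono (P? e) (yes tt) _
        ... | no _  = ≤-reflexive (sym (trans (+-identityʳ _) (+-identityʳ _)))

      open Packing {n} {length remaining} {⌊ d /2⌋} (end₁ ∘ lookup remaining) (end₂ ∘ lookup remaining)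

      partitionCondition : PartitionCondition
      partitionCondition f _ with classes f in eq
      -- With at most one class, `classes f ∸ 1` is `0` and nothing is demanded.
      ... | 0 = ≤-trans (≤-reflexive (*-zeroʳ ⌊ d /2⌋)) z≤n
      ... | 1 = ≤-trans (≤-reflexive (*-zeroʳ ⌊ d /2⌋)) z≤n
      ... | suc (suc q) = partition-arith ⌊ d /2⌋ ⌈ d /2⌉ q (crossing f) (begin
        (2 + q) * (⌊ d /2⌋ + ⌈ d /2⌉) ≡⟨ cong₂ _*_ (sym eq) (⌊n/2⌋+⌈n/2⌉≡n d) ⟩
        classes f * d              ≤⟨ double-count f (subst (2 ≤_) (sym eq) (s≤s (s≤s z≤n))) ⟩
        2 * ∑ allEdges (𝟙 ∘ crosses? f)
          ≤⟨ *-monoʳ-≤ 2 (survivors (crosses? f)) ⟩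
        2 * (∑ remaining (𝟙 ∘ crosses? f) + length S)
          ≤⟨ *-monoʳ-≤ 2 (+-mono-≤ (≤-reflexive (sym (∑-lookup remaining (𝟙 ∘ crosses? f)))) |S|≤) ⟩
        2 * (crossing f + ⌈ d /2⌉)    ∎) (⌊n/2⌋≤⌈n/2⌉ d)
        where open ≤-Reasoning

-- Rooting a connected relation

least : ∀ {P : ℕ → Set} → Decidable P → ∀ {N} → P N → ∃ λ t → P t × (∀ {s} → P s → t ≤ s)
least P? {zero}  p = 0 , p , λ _ → z≤n
least {P} P? {suc N} p with P? 0
... | yes p₀ = 0 , p₀ , λ _ → z≤n
... | no ¬p₀ with least {P ∘ suc} (P? ∘ suc) {N} p
...   | t , pₜ , min = suc t , pₜ , λ { {zero} p₀ → ⊥-elim (¬p₀ p₀) ; {suc s} pₛ → s≤s (min pₛ) }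

module Rooting {n : ℕ} (J : Fin n → Fin n → Set) (J? : ∀ u v → Dec (J u v)) (r : Fin n)
  (conn : ∀ v → Star J v r) where

  Within : ℕ → Fin n → Set
  Within zero    v = v ≡ r
  Within (suc t) v = v ≡ r ⊎ ∃ λ w → J v w × Within t w

  within? : ∀ t → Decidable (Within t)
  within? zero    v = v Fin.≟ r
  within? (suc t) v = (v Fin.≟ r) ⊎-dec Fin.any? (λ w → J? v w ×-dec within? t w)

  star⇒within : ∀ {v} → Star J v r → ∃ λ t → Within t v
  star⇒within ε       = 0 , refl
  star⇒within (j ◅ s) = let t , w = star⇒within s in suc t , inj₂ (_ , j , w)

  distance : ∀ v → ∃ λ t → Within t v × (∀ {s} → Within s v → t ≤ s)
  distance v = least (λ t → within? t v) (proj₂ (star⇒within (conn v)))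

  depth : Fin n → ℕ
  depth v = proj₁ (distance v)

  -- The second vertex of a shortest walk to `r` is closer to `r`.
  parent : ∀ v → v ≡ r ⊎ ∃ λ w → J v w × depth w < depth v
  parent v with distance v
  ... | zero  , v≡r , _                  = inj₁ v≡r
  ... | suc t , inj₁ v≡r , _             = inj₁ v≡r
  ... | suc t , inj₂ (w , j , within) , _ = inj₂ (w , j , s≤s (proj₂ (proj₂ (distance w)) within))

-- Rooted trees in `G` and the heads of edges

module _ {n : ℕ} (G : FinGraph n) where
  open Edges G

  -- The root shares the edge ρ with its child c₀, and the second edge
  -- of the tree in the line graph is the parent edge of s.
  record RootedTree (r : Fin n) (InTree : Edge G → Set) : Set where
    field
      parentEdge : Fin n → Edge G
      parent     : Fin n → Fin n
      depth      : Fin n → ℕ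
      c₀ s       : Fin n
      inTree     : ∀ v → InTree (parentEdge v)
      between    : ∀ v → Between (parentEdge v) v (parent v)
      deeper     : ∀ {v} → v ≢ r → depth (parent v) < depth v
      ρ-shared   : parentEdge c₀ ≡ parentEdge r
      parent-r   : parent r ≡ c₀
      s≢r        : s ≢ r
      s≢c₀       : s ≢ c₀
      parent-s   : parent s ≡ r ⊎ parent s ≡ c₀

    ρ : Edge G
    ρ = parentEdge r

    ρ-between : Between ρ r c₀
    ρ-between = subst (Between ρ r) parent-r (between r)

    parent-unique : ∀ {u v} → Incident (parentEdge u) v → u ≢ v → parent u ≡ v
    parent-unique {u} inc u≢v with between u | inc
    ... | inj₁ (p , q) | inj₁ x = ⊥-elim (u≢v (trans (sym p) x))
    ... | inj₁ (p , q) | inj₂ x = trans (sym q) x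
    ... | inj₂ (p , q) | inj₁ x = trans (sym p) x
    ... | inj₂ (p , q) | inj₂ x = ⊥-elim (u≢v (trans (sym q) x))

    own : ∀ v → Incident (parentEdge v) v
    own v = between⇒incidentˡ (parentEdge v) (between v)

    -- Two vertices other than `r` with a common parent edge would be each other's parents, against
    -- the depths.
    parentEdge-collision : ∀ {u v} → parentEdge u ≡ parentEdge v → u ≢ v → parentEdge u ≡ ρ
    parentEdge-collision {u} {v} eq u≢v with u Fin.≟ r | v Fin.≟ r
    ... | yes refl | _        = refl
    ... | no _     | yes refl = eq
    ... | no u≢r   | no v≢r   = ⊥-elim (<-asym (subst (λ w → depth w < depth u) πu (deeper u≢r))
                                                (subst (λ w → depth w < depth v) πv (deeper v≢r)))
      where
      πu : parent u ≡ v
      πu = parent-unique (subst (λ e → Incident e v) (sym eq) (own v)) u≢v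
      πv : parent v ≡ u
      πv = parent-unique (subst (λ e → Incident e u) eq (own u)) (u≢v ∘ sym)

    ρ-ends : ∀ {v} → parentEdge v ≡ ρ → v ≡ r ⊎ v ≡ c₀
    ρ-ends {v} eq with v Fin.≟ r
    ... | yes v≡r = inj₁ v≡r
    ... | no v≢r  = inj₂ (trans (sym (parent-unique (subst (λ e → Incident e v) eq (own v)) (v≢r ∘ sym))) parent-r)

    s≢ρ : parentEdge s ≢ ρ
    s≢ρ eq = [ s≢r , s≢c₀ ] (ρ-ends eq)

    head : Edge G → Fin n
    head e with e ≟ₑ ρ | parentEdge (end₁ e) ≟ₑ e
    -- The lower end: if each `ρ` had the common root as head, the edges `ρ` of two trees would be
    -- attached to each other.
    ... | yes _ | _     = c₀
    ... | no _  | yes _ = end₂ e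
    ... | no _  | no _  = end₁ e

    head-incident : ∀ e → Incident e (head e)
    head-incident e with e ≟ₑ ρ | parentEdge (end₁ e) ≟ₑ e
    ... | yes refl | _     = between⇒incidentʳ ρ ρ-between
    ... | no _     | yes _ = inj₂ refl
    ... | no _     | no _  = inj₁ refl

    -- For `e` other than `ρ`, the head could own `e` only as `end₂ e`, with `end₁ e` owning `e`
    -- too, a collision. The edge `ρ` joins `r` to its head `c₀`.
    head-own⇒between : ∀ e → parentEdge (head e) ≡ e → Between e r (head e)
    head-own⇒between e eq with e ≟ₑ ρ | parentEdge (end₁ e) ≟ₑ e
    ... | yes refl | _      = ρ-between
    ... | no e≢ρ   | yes p  = ⊥-elim (e≢ρ (trans (sym p) (parentEdge-collision (trans p (sym eq)) (ends-≢ e))))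
    ... | no _     | no ¬p  = ⊥-elim (¬p eq)

    head-own⇒ρ : ∀ e → parentEdge (head e) ≡ e → e ≡ ρ
    head-own⇒ρ e eq with e ≟ₑ ρ | parentEdge (end₁ e) ≟ₑ e
    ... | yes e≡ρ | _      = e≡ρ
    ... | no e≢ρ  | yes p  = trans (sym p) (parentEdge-collision (trans p (sym eq)) (ends-≢ e))
    ... | no _    | no ¬p  = ⊥-elim (¬p eq)

    head-parent : ∀ {v} → parentEdge v ≢ ρ → head (parentEdge v) ≡ parent v
    head-parent {v} ≢ρ with parentEdge v ≟ₑ ρ | parentEdge (end₁ (parentEdge v)) ≟ₑ parentEdge v
    ... | yes ≡ρ | _ = ⊥-elim (≢ρ ≡ρ)
    ... | no _   | yes p with v Fin.≟ end₁ (parentEdge v)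
    ...   | no ne  = ⊥-elim (≢ρ (parentEdge-collision (sym p) ne))
    ...   | yes eq = sym (parent-unique (inj₂ refl) (λ v≡ → ends-≢ (parentEdge v) (trans (sym eq) v≡)))
    head-parent {v} ≢ρ | no _ | no ¬p =
      sym (parent-unique (inj₁ refl) (λ v≡ → ¬p (cong parentEdge (sym v≡))))

  module _ {r u₀ : Fin n} (u₀≢r : u₀ ≢ r) {InTree : Edge G → Set} (inTree? : Decidable InTree)
    (conn : ∀ v → Star (λ u w → ∃ λ e → InTree e × Between e u w) v r)
    (third : ∀ e {u v} → Between e u v → ∃ λ w → w ≢ u × w ≢ v) where

    between? : ∀ e u v → Dec (Between e u v)
    between? e u v = ((end₁ e Fin.≟ u) ×-dec (end₂ e Fin.≟ v)) ⊎-dec ((end₁ e Fin.≟ v) ×-dec (end₂ e Fin.≟ u))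

    private module R = Rooting (λ u w → ∃ λ e → InTree e × Between e u w)
                         (λ u w → any-edge? (λ e → inTree? e ×-dec between? e u w)) r conn

    -- Climbing from `v` to the root, the last vertex before `r` is the child wanted.
    first-child : ∀ N v → R.depth v < N → v ≢ r → ∃ λ c → c ≢ r × ∃ λ e → InTree e × Between e c r × R.depth r < R.depth c
    first-child (suc N) v (s≤s lt) v≢r with R.parent v
    ... | inj₁ v≡r = ⊥-elim (v≢r v≡r)
    ... | inj₂ (w , (e , t , b) , w<v) with w Fin.≟ r
    ...   | yes refl = v , v≢r , e , t , b , w<v
    ...   | no w≢r   = first-child N w (<-≤-trans w<v lt) w≢r

    rootedTree : RootedTree r InTree
    rootedTree with first-child _ u₀ ≤-refl u₀≢r
    ... | c₀ , c₀≢r , ρ , ρ-in , ρ-btw , r<c₀ = record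
      { parentEdge = λ v → proj₁ (up v)
      ; parent     = λ v → proj₁ (proj₂ (up v))
      ; depth      = R.depth
      ; c₀ = c₀ ; s = proj₁ second
      ; inTree     = λ v → proj₁ (proj₂ (proj₂ (up v)))
      ; between    = λ v → proj₁ (proj₂ (proj₂ (proj₂ (up v))))
      ; deeper     = λ {v} → proj₂ (proj₂ (proj₂ (proj₂ (up v))))
      ; ρ-shared   = trans (proj₁ up-c₀) (sym (proj₁ up-r))
      ; parent-r   = proj₂ up-r
      ; s≢r        = proj₁ (proj₂ second)
      ; s≢c₀       = proj₁ (proj₂ (proj₂ second))
      ; parent-s   = proj₂ (proj₂ (proj₂ second))
      }
      where
      Up : Fin n → Set
      Up v = ∃ λ e → ∃ λ w → InTree e × Between e v w × (v ≢ r → R.depth w < R.depth v)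

      up : ∀ v → Up v
      up v with v Fin.≟ r | v Fin.≟ c₀
      ... | yes refl | _        = ρ , c₀ , ρ-in , swap ρ-btw , λ r≢r → ⊥-elim (r≢r refl)
      ... | no _     | yes refl = ρ , r , ρ-in , ρ-btw , λ _ → r<c₀
      ... | no v≢r   | no _ with R.parent v
      ...   | inj₁ v≡r = ⊥-elim (v≢r v≡r)
      ...   | inj₂ (w , (e , t , b) , w<v) = e , w , t , b , λ _ → w<v

      up-r : proj₁ (up r) ≡ ρ × proj₁ (proj₂ (up r)) ≡ c₀
      up-r with r Fin.≟ r
      ... | yes refl = refl , refl
      ... | no ne    = ⊥-elim (ne refl)

      up-c₀ : proj₁ (up c₀) ≡ ρ × proj₁ (proj₂ (up c₀)) ≡ r
      up-c₀ with c₀ Fin.≟ r | c₀ Fin.≟ c₀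
      ... | yes eq | _        = ⊥-elim (c₀≢r eq)
      ... | no _   | yes refl = refl , refl
      ... | no _   | no ne    = ⊥-elim (ne refl)

      Second : Set
      Second = ∃ λ s → s ≢ r × s ≢ c₀ × (proj₁ (proj₂ (up s)) ≡ r ⊎ proj₁ (proj₂ (up s)) ≡ c₀)

      second : Second
      -- The climb starts at a vertex off `ρ` and stops just before it would enter an end of `ρ`.
      second = let w , w≢c₀ , w≢r = third ρ ρ-btw in go _ w ≤-refl w≢r w≢c₀
        where
        go : ∀ N v → R.depth v < N → v ≢ r → v ≢ c₀ → Second
        go (suc N) v (s≤s lt) v≢r v≢c₀ with proj₁ (proj₂ (up v)) Fin.≟ r | proj₁ (proj₂ (up v)) Fin.≟ c₀
        ... | yes p | _     = v , v≢r , v≢c₀ , inj₁ p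
        ... | no _  | yes p = v , v≢r , v≢c₀ , inj₂ p
        ... | no p  | no q  = go N _ (<-≤-trans (proj₂ (proj₂ (proj₂ (proj₂ (up v)))) v≢r) lt) p q

  -- Completely independent spanning trees of the line graph

  module LineTrees {k : ℕ} (S : List (Edge G)) (col : Edge G → Maybe (Fin k))
    (col∉S : ∀ {e i} → col e ≡ just i → e ∉ S) {r : Fin n}
    (tree : ∀ i → RootedTree r (λ e → col e ≡ just i)) where

    module T i = RootedTree (tree i)

    -- One head serves all `k` trees, determined by the tree that has the colour of `e`. For
    -- uncoloured edges the choice of `end₁` is arbitrary.
    head : Edge G → Fin n
    head e = maybe′ (λ j → T.head j e) (end₁ e) (col e)

    head-col : ∀ {e j} → col e ≡ just j → head e ≡ T.head j e
    head-col {e} eq = cong (maybe′ (λ j → T.head j e) (end₁ e)) eq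

    head-incident : ∀ e → Incident e (head e)
    head-incident e with col e
    ... | nothing = inj₁ refl
    ... | just j  = T.head-incident j e

    colours-≢ : ∀ {e f i j} → i ≢ j → col e ≡ just i → col f ≡ just j → e ≢ f
    colours-≢ i≢j p q refl = i≢j (Maybe.just-injective (trans (sym p) q))

    -- The head of `ρ` has `ρ` itself as parent edge, so `ρ` needs another pointer: the parent edge
    -- of `s`, which meets `ρ` and points back to it.
    target : Fin k → Edge G → Fin n
    target i e with e ≟ₑ T.ρ i
    ... | yes _ = T.s i
    ... | no _  = head e

    target-ρ : ∀ i → target i (T.ρ i) ≡ T.s i
    target-ρ i with T.ρ i ≟ₑ T.ρ i
    ... | yes _ = refl
    ... | no ne = ⊥-elim (ne refl)

    target-≢ρ : ∀ i {e} → e ≢ T.ρ i → target i e ≡ head e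
    target-≢ρ i {e} ne with e ≟ₑ T.ρ i
    ... | yes eq = ⊥-elim (ne eq)
    ... | no _   = refl

    target-parent : ∀ i {v} → T.parentEdge i v ≢ T.ρ i → target i (T.parentEdge i v) ≡ T.parent i v
    target-parent i {v} ne = trans (target-≢ρ i ne) (trans (head-col (T.inTree i v)) (T.head-parent i ne))

    node : Fin k → Fin n → V (LineGraph G ─ S)
    node i v = T.parentEdge i v , col∉S (T.inTree i v)

    -- The proof of `∉ S` inside a node is computed from a colour equation; such equations have
    -- unique proofs, so nodes over the same edge are equal.
    node-cong : ∀ i {u v} → T.parentEdge i u ≡ T.parentEdge i v → node i u ≡ node i v
    node-cong i {u} {v} = go (T.inTree i u) (T.inTree i v)
      where
      go : ∀ {e f} (p : col e ≡ just i) (q : col f ≡ just i) → e ≡ f → (e , col∉S p) ≡ (f , col∉S q)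
      go p q refl = cong (λ p → _ , col∉S p) (WithK.≡-irrelevant p q)

    par : Fin k → V (LineGraph G ─ S) → V (LineGraph G ─ S)
    par i (e , _) = node i (target i e)

    par-adj : ∀ i x → Adj (LineGraph G ─ S) x (par i x)
    par-adj i (e , _) with e ≟ₑ T.ρ i
    ... | yes refl = T.s≢ρ i ∘ sym
                   , incident⇒shareEnd e (T.parentEdge i (T.s i)) (ρ-s (T.parent-s i)) (between⇒incidentʳ (T.parentEdge i (T.s i)) (T.between i (T.s i)))
      where
      ρ-s : T.parent i (T.s i) ≡ r ⊎ T.parent i (T.s i) ≡ T.c₀ i → Incident (T.ρ i) (T.parent i (T.s i))
      ρ-s (inj₁ eq) = subst (Incident (T.ρ i)) (sym eq) (between⇒incidentˡ (T.ρ i) (T.ρ-between i))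
      ρ-s (inj₂ eq) = subst (Incident (T.ρ i)) (sym eq) (between⇒incidentʳ (T.ρ i) (T.ρ-between i))
    ... | no e≢ρ = (λ eq → e≢ρ (loop eq)) , incident⇒shareEnd e (T.parentEdge i (head e)) (head-incident e) (T.own i (head e))
      where
      loop : e ≡ T.parentEdge i (head e) → e ≡ T.ρ i
      loop eq = T.head-own⇒ρ i e (trans (cong (T.parentEdge i) (sym (head-col col-e))) (sym eq))
        where
        col-e : col e ≡ just i
        col-e = subst (λ e → col e ≡ just i) (sym eq) (T.inTree i (head e))

    -- From `ρ` the pointer goes to the parent edge of `s`, and from there to that of `parent s`,
    -- which is `r` or `c₀`. Both have parent edge `ρ`.
    par²ρ : ∀ i → par i (par i (node i r)) ≡ node i r
    par²ρ i = trans (cong (node i ∘ target i ∘ T.parentEdge i) (target-ρ i))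
                    (node-cong i (trans (cong (T.parentEdge i) (target-parent i (T.s≢ρ i))) (back (T.parent-s i))))
      where
      back : T.parent i (T.s i) ≡ r ⊎ T.parent i (T.s i) ≡ T.c₀ i → T.parentEdge i (T.parent i (T.s i)) ≡ T.ρ i
      back (inj₁ eq) = cong (T.parentEdge i) eq
      back (inj₂ eq) = trans (cong (T.parentEdge i) eq) (T.ρ-shared i)

    -- The pointer of the parent edge of `v` leads to that of the parent of `v`, so the depth drops
    -- until `ρ` is met.
    reach-node : ∀ i N v → T.depth i v < N → ∃ λ M → iter (par i) M (node i v) ≡ node i r
    reach-node i (suc N) v (s≤s lt) with T.parentEdge i v ≟ₑ T.ρ i
    ... | yes eq = 0 , node-cong i eq
    ... | no ne with reach-node i N (T.parent i v) (<-≤-trans (T.deeper i (λ { refl → ne refl })) lt)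
    ...   | M , eq = suc M , trans (cong (iter (par i) M ∘ node i) (target-parent i ne)) eq

    reach : ∀ i x → ∃ λ M → iter (par i) M x ≡ node i r
    reach i (e , _) with reach-node i _ (target i e) ≤-refl
    ... | M , eq = suc M , eq

    disjoint : ∀ {i j} → i ≢ j → ∀ x y → par i x ≢ par j y
    disjoint {i} {j} i≢j x y eq = colours-≢ i≢j (T.inTree i _) (T.inTree j _) (cong proj₁ eq)

    -- If e and f point to each other, their heads are distinct common ends, or they have the same head w and
    -- are both the edge r w.
    edges-no-conflict : ∀ {i j} → i ≢ j → ∀ {e f} → col f ≡ just i → col e ≡ just j →
                        f ≡ T.parentEdge i (head e) → e ≡ T.parentEdge j (head f) → ⊥
    edges-no-conflict {i} {j} i≢j {e} {f} col-f col-e f≡ e≡ with head e Fin.≟ head f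
    ... | no ne = colours-≢ i≢j col-f col-e (between-unique {f} {e}
            (incident⇒between f ne (subst (λ x → Incident x (head e)) (sym f≡) (T.own i (head e))) (head-incident f))
            (incident⇒between e ne (head-incident e) (subst (λ x → Incident x (head f)) (sym e≡) (T.own j (head f)))))
    ... | yes eq = colours-≢ i≢j col-f col-e (between-unique {f} {e}
            (subst (Between f r) (trans (sym (head-col col-f)) (sym eq))
              (T.head-own⇒between i f (trans (cong (T.parentEdge i) (trans (sym (head-col col-f)) (sym eq))) (sym f≡))))
            (subst (Between e r) (sym (head-col col-e))
              (T.head-own⇒between j e (trans (cong (T.parentEdge j) (trans (sym (head-col col-e)) eq)) (sym e≡)))))

    no-conflict : ∀ {i j} → i ≢ j → ∀ x → par j (par i x) ≢ x
    no-conflict {i} {j} i≢j (e , _) eq = edges-no-conflict i≢j col-f col-e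
        -- Having the other tree's colour, `e` is not the `ρ` of tree `i`, nor `f` that of tree `j`;
        -- so both pointers go by heads.
        (cong (T.parentEdge i) (target-≢ρ i (colours-≢ (i≢j ∘ sym) col-e (T.inTree i r))))
        (trans (sym e≡) (cong (T.parentEdge j) (target-≢ρ j (colours-≢ i≢j col-f (T.inTree j r)))))
      where
      f : Edge G
      f = T.parentEdge i (target i e)
      col-f : col f ≡ just i
      col-f = T.inTree i (target i e)
      e≡ : T.parentEdge j (target j f) ≡ e
      e≡ = cong proj₁ eq
      col-e : col e ≡ just j
      col-e = subst (λ e → col e ≡ just j) e≡ (T.inTree j _)

    cists : HasCISTs (LineGraph G ─ S) k
    cists = PointerTrees.cists (LineGraph G ─ S) par par-adj (λ i → node i r) par²ρ reach disjoint no-conflict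

  -- From large edge cuts to trees of the line graph

  open EdgeCuts G

  module _ {d : ℕ} (cut-≥ : ∀ F → IsEdgeCut G F → d ≤ length F) where

    -- If `u` and `v` were the only vertices, the single edge `e` would be an edge cut.
    third-vertex : 2 ≤ d → ∀ e {u v} → Between e u v → ∃ λ w → w ≢ u × w ≢ v
    third-vertex 2≤d e {u} {v} btw with Fin.any? (λ w → ¬? (w Fin.≟ u) ×-dec ¬? (w Fin.≟ v))
    ... | yes third = third
    ... | no none = ⊥-elim (<-irrefl refl (≤-trans 2≤d (cut-≥ (e ∷ []) ((All.[] ∷ []) , λ { (_ , conn) → apart (conn u v) }))))
      where
      apart : ¬ Star (Adj (removeEdges G (e ∷ []))) u v
      apart ε = between-≢ e btw refl
      apart (_◅_ {j = w} (uw , ∉e) _) with w Fin.≟ v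
      ... | yes refl = ∉e (here btw)
      ... | no w≢v   = none (w , (λ { refl → adj-irr′ G uw }) , w≢v)

    line-cists : ∀ S → (∃ λ e → e ∉ S) → length S ≤ ⌈ d /2⌉ → HasCISTs (LineGraph G ─ S) ⌊ d /2⌋
    line-cists S (e₀ , _) |S|≤ = LineTrees.cists S colour colour∉S λ i →
        -- The edge `e₀` supplies the common root and a second vertex to climb from.
        rootedTree {r = end₁ e₀} {end₂ e₀} (ends-≢ e₀ ∘ sym)
          (λ e → Maybe.≡-dec Fin._≟_ (colour e) (just i))
          (λ v → Star.map (transfer i) (spanning i v (end₁ e₀)))
          -- The index `i` of a tree witnesses that half of `d`, rounded down, is positive.
          (third-vertex (half⇒2≤ d i))
      where
      rem : List (Edge G)
      rem = remaining d cut-≥ S |S|≤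

      open Packing {n} {length rem} {⌊ d /2⌋} (end₁ ∘ lookup rem) (end₂ ∘ lookup rem)
        using (Spanning; spanning-trees)

      packing : ∃ Spanning
      packing = spanning-trees (partitionCondition d cut-≥ S |S|≤)

      spanning : Spanning (proj₁ packing)
      spanning = proj₂ packing

      half⇒2≤ : ∀ d → Fin ⌊ d /2⌋ → 2 ≤ d
      half⇒2≤ (suc (suc _)) _ = s≤s (s≤s z≤n)

      colour : Edge G → Maybe (Fin ⌊ d /2⌋)
      colour e with e ∈? rem
      ... | yes e∈ = proj₁ packing (Any.index e∈)
      ... | no _   = nothing

      colour∉S : ∀ {e i} → colour e ≡ just i → e ∉ S
      colour∉S {e} eq with e ∈? rem
      ... | yes e∈ = proj₂ (∈-filter⁻ (λ e → ¬? (e ∈? S)) {xs = allEdges} e∈)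

      colour-lookup : ∀ j → colour (lookup rem j) ≡ proj₁ packing j
      colour-lookup j with lookup rem j ∈? rem
      ... | yes e∈ = cong (proj₁ packing) (lookup-injective (Unique.filter⁺ (λ e → ¬? (e ∈? S)) allEdges-unique)
                                             (sym (Any.lookup-index e∈)))
      ... | no e∉  = ⊥-elim (e∉ (∈-lookup j))

      transfer : ∀ i {u w} → (∃ λ j → proj₁ packing j ≡ just i × Multigraph.Joins (end₁ ∘ lookup rem) (end₂ ∘ lookup rem) j u w) →
                 ∃ λ e → colour e ≡ just i × Between e u w
      transfer i (j , p , joins) = lookup rem j , trans (colour-lookup j) p , joins

theorem10 : ∀ {n} (G : FinGraph n) → Connected (toGraph G) →
    ∀ (δ κ : ℕ) → IsMinDegree G δ → IsConnectivity (LineGraph G) κ →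
    (∀ (S : List (Edge G)) → Unique S → (∃ λ e → e ∉ S) →
    length S ≤ ⌈ δ ⊓ κ /2⌉ → HasCISTs (LineGraph G ─ S) ⌊ δ ⊓ κ /2⌋)
    × (¬ SuperEdgeConnected G →
    ∀ (S : List (Edge G)) → Unique S → (∃ λ e → e ∉ S) →
    length S ≤ ⌈ κ /2⌉ → HasCISTs (LineGraph G ─ S) ⌊ κ /2⌋)
theorem10 G G-conn δ κ isδ isκ =
    (λ S _ → line-cists G (EdgeCuts.cut-≥-min G isδ isκ) S)
  , (λ ¬super S _ → line-cists G (EdgeCuts.cut-≥-κ G G-conn isκ ¬super) S)
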